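{- There are absolute constants $c>0$ and $C\ge 1$ such that for all integers $h\ge 1$, $n\ge 1$ and all $D\ge 2$, there is an undirected graph $G=(V,E)$ with positive edge lengths, highway dimension $h$, diameter between $D/C$ and $CD$, and $|V|\ge n$, such that for every contraction ordering of $V$, the set $E^+$ of shortcut edges produced by contraction hierarchies preprocessing satisfies $|E^+|\ge c\,h|V|\log D$.
   Context: Graphs are undirected with nonnegative edge lengths (ties in shortest paths may be assumed broken so shortest paths are unique); $\mathrm{dist}$ is shortest-path distance and the diameter is $\max_{u,v}\mathrm{dist}(u,v)$. $B_r(v)=\{u:\mathrm{dist}(u,v)<r\}$. A set of vertices covers a set of paths if every path contains a vertex of the set. The highway dimension of $G$ is the smallest $h$ such that for every $r>0$ and $v\in V$ there is $H\subseteq V$, $|H|\le h$, covering all shortest paths of length $\ge r$ contained in $B_{4r}(v)$. Contraction hierarchies preprocessing: given a contraction ordering (a total order of $V$), vertices are contracted in this order; contracting $v$ deletes $v$ from the current graph and, for each pair of neighbors $u,w$ of $v$ such that $u$–$v$–$w$ is the unique shortest $u$–$w$ path in the current graph, adds a shortcut edge $u$–$w$ of length $\ell(u,v)+\ell(v,w)$; $E^+$ is the set of all shortcut edges added over the whole process. Logarithms are base 2.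
   Formalization: D ranges over rational numbers at least 2 instead of all real numbers at least 2; the real case follows by choosing a rational D' between D and 2D and doubling C. -}

module Defs where

open import Level using (0ℓ)
open import Data.Nat as ℕ using (ℕ; zero; suc)
open import Data.Integer using (+_)
open import Data.Fin as Fin using (Fin)
open import Data.Maybe using (Maybe; just; nothing)
open import Data.Product using (Σ; Σ-syntax; ∃; _×_; _,_)
open import Data.Sum using (_⊎_)
open import Data.List using (List; []; _∷_; length)
open import Data.List.Membership.Propositional using (_∈_; _∉_)
open import Data.List.Relation.Unary.All using (All)
open import Data.List.Relation.Unary.Any using (Any)
open import Data.List.Relation.Unary.Unique.Propositional using (Unique)
open import Data.Rational as ℚ using (ℚ; 0ℚ; 1ℚ; _/_)
open import Relation.Binary.PropositionalEquality using (_≡_; _≢_)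
open import Relation.Nullary using (¬_)
open import Function.Bundles using (_⇔_)

ℕ→ℚ : ℕ → ℚ
ℕ→ℚ n = + n / 1

_^ℚ_ : ℚ → ℕ → ℚ
p ^ℚ zero  = 1ℚ
p ^ℚ suc k = p ℚ.* (p ^ℚ k)

-- Weighted graphs on the vertex set Fin N.
-- A weight table gives, for each ordered pair, either no edge (nothing)
-- or an edge of the given length.

Weights : ℕ → Set
Weights N = Fin N → Fin N → Maybe ℚ

record Graph : Set where
  field
    N   : ℕ
    len : Weights N
    sym : ∀ u v → len u v ≡ len v u
    noLoop : ∀ u → len u u ≡ nothing
    pos : ∀ u v l → len u v ≡ just l → 0ℚ ℚ.< l
open Graph public

module _ {N : ℕ} where

  data Walk (w : Weights N) (A : Fin N → Set) : Fin N → Fin N → List (Fin N) → ℚ → Set where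
    here : ∀ {u} → A u → Walk w A u u (u ∷ []) 0ℚ
    step : ∀ {u x v xs l d} → A u → w u x ≡ just l →
           Walk w A x v xs d → Walk w A u v (u ∷ xs) (l ℚ.+ d)

  Shortest : Weights N → (Fin N → Set) → Fin N → Fin N → List (Fin N) → ℚ → Set
  Shortest w A u v p d =
    Walk w A u v p d × (∀ q e → Walk w A u v q e → d ℚ.≤ e)

  UniqueShortest : Weights N → (Fin N → Set) → Fin N → Fin N → List (Fin N) → Set
  UniqueShortest w A u v p =
    Σ[ d ∈ ℚ ] (Walk w A u v p d × (∀ q e → Walk w A u v q e → q ≢ p → d ℚ.< e))

AllV : ∀ {N} → Fin N → Set
AllV _ = Data.Unit.⊤
  where import Data.Unit

DistLt : (G : Graph) → Fin (N G) → Fin (N G) → ℚ → Set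
DistLt G u v r = Σ[ p ∈ List (Fin (N G)) ] Σ[ d ∈ ℚ ] (Walk (len G) AllV u v p d × d ℚ.< r)

DistLe : (G : Graph) → Fin (N G) → Fin (N G) → ℚ → Set
DistLe G u v r = Σ[ p ∈ List (Fin (N G)) ] Σ[ d ∈ ℚ ] (Walk (len G) AllV u v p d × d ℚ.≤ r)

DistGe : (G : Graph) → Fin (N G) → Fin (N G) → ℚ → Set
DistGe G u v r = ∀ p d → Walk (len G) AllV u v p d → r ℚ.≤ d

HDAtMost : Graph → ℕ → Set
HDAtMost G k =
  ∀ (r : ℚ) → 0ℚ ℚ.< r → ∀ (v : Fin (N G)) →
  Σ[ H ∈ List (Fin (N G)) ] (length H ℕ.≤ k ×
    (∀ u x p d → Shortest (len G) AllV u x p d → r ℚ.≤ d →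
       All (λ y → DistLt G y v (ℕ→ℚ 4 ℚ.* r)) p →
       Any (λ y → y ∈ H) p))

-- the highway dimension of G is exactly h (smallest such bound), h ≥ 1
HighwayDim : Graph → ℕ → Set
HighwayDim G h = HDAtMost G h × ¬ HDAtMost G (h ℕ.∸ 1)

-- D/C ≤ diameter ≤ C·D, where diameter = max over u,v of dist(u,v).
-- The lower bound D/C ≤ dist(u,v) is written D ≤ C·dist(u,v) (C ≥ 1).
DiameterBetween : Graph → ℕ → ℚ → Set
DiameterBetween G C D =
  (Σ[ u ∈ Fin (N G) ] Σ[ v ∈ Fin (N G) ]
     (∀ p d → Walk (len G) AllV u v p d → D ℚ.≤ ℕ→ℚ C ℚ.* d)) ×
  (∀ u v → DistLe G u v (ℕ→ℚ C ℚ.* D))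

-- Contraction hierarchies.
-- The current graph is given by a weight table w and the set of
-- not-yet-contracted vertices (those not in the list R).

module _ {N : ℕ} where

  Alive : List (Fin N) → Fin N → Set
  Alive R u = u ∉ R

  Shortcut : Weights N → List (Fin N) → Fin N → Fin N → Fin N → Set
  Shortcut w R v u x = UniqueShortest w (Alive R) u x (u ∷ v ∷ x ∷ [])

  -- Contracting v in the current graph (w, R) yields weight table w'
  -- and adds exactly k shortcut edges (unordered pairs {u,x}, counted once).
  -- A shortcut u–x of length ℓ(u,v)+ℓ(v,x) is strictly shorter than any
  -- existing u–x edge, so it replaces it in the (simple) weight table.
  record Step (w : Weights N) (R : List (Fin N)) (v : Fin N) (w' : Weights N) (k : ℕ) : Set where
    field
      shortcuts : List (Fin N × Fin N)
      count     : length shortcuts ≡ k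
      unique    : Unique shortcuts
      spec      : ∀ u x → ((u , x) ∈ shortcuts) ⇔ (u Fin.< x × Shortcut w R v u x)
      new       : ∀ u x → Shortcut w R v u x → ∀ l₁ l₂ →
                  w u v ≡ just l₁ → w v x ≡ just l₂ → w' u x ≡ just (l₁ ℚ.+ l₂)
      old       : ∀ u x → ¬ Shortcut w R v u x → w' u x ≡ w u x

  data Run : Weights N → List (Fin N) → List (Fin N) → ℕ → Set where
    done : ∀ {w R} → Run w R [] 0
    next : ∀ {w R v vs w' k m} → Step w R v w' k → Run w' (v ∷ R) vs m →
           Run w R (v ∷ vs) (k ℕ.+ m)

ShortcutCount : (G : Graph) → List (Fin (N G)) → ℕ → Set
ShortcutCount G ord k = Run (len G) [] ord k

{-# OPTIONS --safe #-}
module Submission where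

-- The graph is a tree of clusters with M branches per level and 2J levels,
-- J ≈ log D.  At the bottom, every label t and address a carry a pair of nodes
-- at distance 2.  A cluster of height i has h hubs of scale 64 ^ i, joined to all
-- nodes below of one parity, where the two nodes of a pair have opposite
-- parities and the parity alternates with i.  Since the scales are far apart,
-- a ball of radius 4r meets long shortest paths of one scale and one cluster
-- only, and these are covered by the h hubs of that cluster.
--
-- Contracting the first node of a pair joins its partner to every living hub
-- above it of the right parity.  Killing a hub beforehand does not pay: hub t is
-- slightly closer to the nodes of label t than the other hubs, so it lies on the
-- unique shortest path between any two nodes of label t in different branches
-- of its cluster, and contracting it while many of them are alive costs
-- quadratically many shortcuts.

open import Defs
open import Data.Bool.Base using (Bool; true; false; not; if_then_else_)
import Data.Bool.Properties as 𝔹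
open import Data.Fin as Fin using (Fin; zero; suc)
import Data.Fin.Properties as Fin
import Data.Integer as ℤ
import Data.Integer.Properties as ℤ
open import Data.List using (List; []; _∷_; _++_; length; map; filter; lookup; allFin; cartesianProduct; cartesianProductWith)
open import Data.List.Membership.Propositional using (_∈_; _∉_)
open import Data.List.Membership.Propositional.Properties
import Data.List.Membership.DecPropositional as DecMembership
import Data.List.Properties as List
open import Data.List.Relation.Binary.Permutation.Propositional as ↭ using (_↭_; ↭-sym)
open import Data.List.Relation.Binary.Permutation.Propositional.Properties using (∈-resp-↭; map⁺)
import Data.List.Relation.Binary.Permutation.Setoid.Properties as SetoidPerm
open import Data.List.Relation.Unary.All as All using (All; []; _∷_)
import Data.List.Relation.Unary.All.Properties as All
open import Data.List.Relation.Unary.AllPairs using ([]; _∷_)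
open import Data.List.Relation.Unary.Any as Any using (Any; here; there)
import Data.List.Relation.Unary.Any.Properties as Any
open import Data.List.Relation.Unary.Unique.Propositional using (Unique)
import Data.List.Relation.Unary.Unique.Propositional.Properties as Unique
open import Data.Maybe as Maybe using (Maybe; just; nothing)
import Data.Maybe.Properties as Maybe
open import Data.Nat as ℕ using (ℕ; zero; suc; _+_; _*_; _∸_; _^_; _≤_; _<_; z≤n; s≤s)
import Data.Nat.Properties as ℕ
open import Data.Nat.ListAction using (sum)
open import Data.Nat.ListAction.Properties using (sum-↭; sum-++)
open import Data.Nat.Solver using (module +-*-Solver)
open import Data.Product using (Σ-syntax; ∃-syntax; _×_; _,_; proj₁; proj₂; swap)
import Data.Product.Properties as Product
open import Data.Rational as ℚ using (ℚ; 0ℚ; 1ℚ)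
import Data.Rational.Properties as ℚ
open import Data.Unit using (⊤)
open import Data.Sum using (_⊎_; inj₁; inj₂; [_,_]′)
open import Data.Vec as Vec using (Vec; []; _∷_)
import Data.Vec.Properties as Vec
open import Function using (_∘_; id; case_of_)
open import Function.Bundles using (Equivalence)
open import Relation.Binary.PropositionalEquality as ≡ using (_≡_; _≢_; refl; cong; cong₂; trans; subst; subst₂; ≢-sym)
open import Relation.Nullary using (¬_; Dec; yes; no; does; contradiction; ¬?)
open import Relation.Nullary.Decidable using (_×-dec_; _⊎-dec_; decidable-stable; map′)
open import Relation.Unary using (Decidable)
open import Relation.Binary.Definitions using (tri<; tri≈; tri>)
open import Algebra.Properties.Group ℚ.+-0-group using (⁻¹-involutive)
open import Data.Nat.Coprimality using (1-coprimeTo) renaming (sym to coprime-sym)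

-- The main obstacle is an ordering that removes hubs before pairs can be charged to them. The
-- quadratic price of hub `t` is paid only through nodes of label `t`. Once those pairs are broken,
-- the hub can be removed cheaply, although pairs of other labels still rely on it. Hence the
-- potential sums over ordered pairs of labels at each address and counts an entry only while both
-- labels are intact: whichever pair is broken first sees the hubs of the other label, and these are
-- still protected. Parity answers a second ordering. If the hubs were attached to one node of each
-- pair only, contracting the other node first would add no shortcut. With alternating parity each
-- node sees `J` of the `2J` hubs of each label above it, so either order is charged. Shortcuts keep
-- changing the current graph, so its distances are never computed. A potential chosen on the
-- original graph certifies a two-edge path for as long as its three vertices are alive.

-- Naturals inside the rationals

<⇒≱ℚ : ∀ {p q} → p ℚ.< q → ¬ (q ℚ.≤ p)
<⇒≱ℚ p<q q≤p = ℚ.<-irrefl refl (ℚ.<-≤-trans p<q q≤p)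

ℕ→ℚ-mkℚ : ∀ n → ℕ→ℚ n ≡ ℚ.mkℚ (ℤ.+ n) 0 (coprime-sym (1-coprimeTo n))
ℕ→ℚ-mkℚ n = ℚ.normalize-coprime (coprime-sym (1-coprimeTo n))

ℕ→ℚ-+ : ∀ m n → ℕ→ℚ (m + n) ≡ ℕ→ℚ m ℚ.+ ℕ→ℚ n
ℕ→ℚ-+ m n rewrite ℕ→ℚ-mkℚ m | ℕ→ℚ-mkℚ n =
  cong (λ z → z ℚ./ 1) (≡.sym (cong₂ ℤ._+_ (ℤ.*-identityʳ (ℤ.+ m)) (ℤ.*-identityʳ (ℤ.+ n))))

ℕ→ℚ-* : ∀ m n → ℕ→ℚ (m * n) ≡ ℕ→ℚ m ℚ.* ℕ→ℚ n
ℕ→ℚ-* m n rewrite ℕ→ℚ-mkℚ m | ℕ→ℚ-mkℚ n = cong (λ z → z ℚ./ 1) (ℤ.pos-* m n)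

ℕ→ℚ-mono-≤ : ∀ {m n} → m ≤ n → ℕ→ℚ m ℚ.≤ ℕ→ℚ n
ℕ→ℚ-mono-≤ {m} {n} m≤n rewrite ℕ→ℚ-mkℚ m | ℕ→ℚ-mkℚ n =
  ℚ.*≤* (ℤ.*-monoʳ-≤-nonNeg (ℤ.+ 1) (ℤ.+≤+ m≤n))

ℕ→ℚ-mono-< : ∀ {m n} → m < n → ℕ→ℚ m ℚ.< ℕ→ℚ n
ℕ→ℚ-mono-< {m} {n} m<n rewrite ℕ→ℚ-mkℚ m | ℕ→ℚ-mkℚ n =
  ℚ.*<* (ℤ.*-monoʳ-<-pos (ℤ.+ 1) (ℤ.+<+ m<n))

ℕ→ℚ-cancel-≤ : ∀ {m n} → ℕ→ℚ m ℚ.≤ ℕ→ℚ n → m ≤ n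
ℕ→ℚ-cancel-≤ le = ℕ.≮⇒≥ (λ n<m → <⇒≱ℚ (ℕ→ℚ-mono-< n<m) le)

-- Potentials certifying shortcuts

module _ {N : ℕ} where

  -- Such a potential forces x–c–y to be the unique shortest path from x to y, and
  -- it survives every contraction of another vertex: an edge added at z
  -- cannot be tight, since the tight edges meet only at c.
  record Cert (w : Weights N) (x c y : Fin N) : Set where
    field
      Φ     : Fin N → ℚ
      slope : ∀ u v l → w u v ≡ just l →
              Φ v ℚ.< Φ u ℚ.+ l ⊎ (Φ v ≡ Φ u ℚ.+ l × ((u ≡ x × v ≡ c) ⊎ (u ≡ c × v ≡ y)))
      l₁ l₂ : ℚ
      e₁    : w x c ≡ just l₁
      e₂    : w c y ≡ just l₂
      rise₁ : Φ c ≡ Φ x ℚ.+ l₁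
      rise₂ : Φ y ≡ Φ c ℚ.+ l₂
      Φx<Φc : Φ x ℚ.< Φ c
      Φc<Φy : Φ c ℚ.< Φ y

    slope≤ : ∀ u v l → w u v ≡ just l → Φ v ℚ.≤ Φ u ℚ.+ l
    slope≤ u v l e with slope u v l e
    ... | inj₁ lt       = ℚ.<⇒≤ lt
    ... | inj₂ (eq , _) = ℚ.≤-reflexive eq

    x≢c : x ≢ c
    x≢c refl = ℚ.<-irrefl refl Φx<Φc

    c≢y : c ≢ y
    c≢y refl = ℚ.<-irrefl refl Φc<Φy

    x≢y : x ≢ y
    x≢y refl = ℚ.<-asym Φx<Φc Φc<Φy

  +-slopes-≤-< : ∀ a l {b c m} → b ℚ.≤ a ℚ.+ l → c ℚ.< b ℚ.+ m → c ℚ.< a ℚ.+ (l ℚ.+ m)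
  +-slopes-≤-< a l {b} {c} {m} p q =
    ℚ.<-≤-trans q (ℚ.≤-trans (ℚ.+-monoˡ-≤ m p) (ℚ.≤-reflexive (ℚ.+-assoc a l m)))

  +-slopes-<-≤ : ∀ a l {b c m} → b ℚ.< a ℚ.+ l → c ℚ.≤ b ℚ.+ m → c ℚ.< a ℚ.+ (l ℚ.+ m)
  +-slopes-<-≤ a l {b} {c} {m} p q =
    ℚ.≤-<-trans q (ℚ.<-≤-trans (ℚ.+-monoˡ-< m p) (ℚ.≤-reflexive (ℚ.+-assoc a l m)))

  +-slopes-≤ : ∀ a l {b c m} → b ℚ.≤ a ℚ.+ l → c ℚ.≤ b ℚ.+ m → c ℚ.≤ a ℚ.+ (l ℚ.+ m)
  +-slopes-≤ a l {b} {c} {m} p q =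
    ℚ.≤-trans q (ℚ.≤-trans (ℚ.+-monoˡ-≤ m p) (ℚ.≤-reflexive (ℚ.+-assoc a l m)))

  +-cancelˡ-< : ∀ a {b c} → a ℚ.+ b ℚ.< a ℚ.+ c → b ℚ.< c
  +-cancelˡ-< a lt = ℚ.≰⇒> (λ le → <⇒≱ℚ lt (ℚ.+-monoʳ-≤ a le))

  module _ {w : Weights N} {x c y : Fin N} (C : Cert w x c y) where
    open Cert C

    walk-slope : ∀ {A u v p d} → Walk w A u v p d → Φ v ℚ.≤ Φ u ℚ.+ d
    walk-slope {u = u} (here _) = ℚ.≤-reflexive (≡.sym (ℚ.+-identityʳ (Φ u)))
    walk-slope (step {u} {l = l} _ e W) = +-slopes-≤ (Φ u) l (slope≤ _ _ _ e) (walk-slope W)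

    private
      from-y : ∀ {A p d} → Walk w A y y p d → p ≢ y ∷ [] → Φ y ℚ.< Φ y ℚ.+ d
      from-y (here _) p≢ = contradiction refl p≢
      from-y (step {l = l} _ e W) _ with slope _ _ _ e
      ... | inj₁ lt                     = +-slopes-<-≤ (Φ y) l lt (walk-slope W)
      ... | inj₂ (_ , inj₁ (y≡x , _)) = contradiction (≡.sym y≡x) x≢y
      ... | inj₂ (_ , inj₂ (y≡c , _)) = contradiction (≡.sym y≡c) c≢y

      from-c : ∀ {A p d} → Walk w A c y p d → p ≢ c ∷ y ∷ [] → Φ y ℚ.< Φ c ℚ.+ d
      from-c W p≢ = go W p≢ refl
        where
        go : ∀ {A v p d} → Walk w A c v p d → p ≢ c ∷ y ∷ [] → v ≡ y → Φ v ℚ.< Φ c ℚ.+ d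
        go (here _) _ c≡y = contradiction c≡y c≢y
        go (step {l = l} _ e W) p≢ refl with slope _ _ _ e
        ... | inj₁ lt                     = +-slopes-<-≤ (Φ c) l lt (walk-slope W)
        ... | inj₂ (_ , inj₁ (c≡x , _)) = contradiction (≡.sym c≡x) x≢c
        ... | inj₂ (eq , inj₂ (_ , refl)) =
          +-slopes-≤-< (Φ c) l (ℚ.≤-reflexive eq) (from-y W (λ { refl → p≢ refl }))

    -- The rise of `Φ` along a walk is at most its length, and equality forces every edge to be
    -- tight. The tight edges form the single path `x`, `c`, `y`, and none leaves `y`, so every
    -- other walk loses something.
    strict-walk : ∀ {A p d} → Walk w A x y p d → p ≢ x ∷ c ∷ y ∷ [] → Φ y ℚ.< Φ x ℚ.+ d
    strict-walk W p≢ = go W p≢ refl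
      where
      go : ∀ {A v p d} → Walk w A x v p d → p ≢ x ∷ c ∷ y ∷ [] → v ≡ y → Φ v ℚ.< Φ x ℚ.+ d
      go (here _) _ x≡y = contradiction x≡y x≢y
      go (step {l = l} _ e W) p≢ refl with slope _ _ _ e
      ... | inj₁ lt                     = +-slopes-<-≤ (Φ x) l lt (walk-slope W)
      ... | inj₂ (_ , inj₂ (x≡c , _)) = contradiction x≡c x≢c
      ... | inj₂ (eq , inj₁ (_ , refl)) =
        +-slopes-≤-< (Φ x) l (ℚ.≤-reflexive eq) (from-c W (λ { refl → p≢ refl }))

    Cert⇒Shortcut : ∀ {R} → x ∉ R → c ∉ R → y ∉ R → Shortcut w R c x y
    Cert⇒Shortcut x∉ c∉ y∉ =
      l₁ ℚ.+ (l₂ ℚ.+ 0ℚ) , step x∉ e₁ (step c∉ e₂ (here y∉)) ,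
      λ q e W q≢ → +-cancelˡ-< (Φ x) (subst (ℚ._< Φ x ℚ.+ e) total (strict-walk W q≢))
      where
      total : Φ y ≡ Φ x ℚ.+ (l₁ ℚ.+ (l₂ ℚ.+ 0ℚ))
      total = trans rise₂ (trans (cong (ℚ._+ l₂) rise₁) (trans (ℚ.+-assoc (Φ x) l₁ l₂)
                (cong (λ z → Φ x ℚ.+ (l₁ ℚ.+ z)) (≡.sym (ℚ.+-identityʳ l₂)))))

    module _ {R z w' k} (S : Step w R z w' k) (z≢x : z ≢ x) (z≢c : z ≢ c) (z≢y : z ≢ y) where
      open Step S

      private
        into-z : ∀ {u l} → w u z ≡ just l → Φ z ℚ.< Φ u ℚ.+ l
        into-z e with slope _ _ _ e
        ... | inj₁ lt = lt
        ... | inj₂ (_ , inj₁ (_ , z≡c)) = contradiction z≡c z≢c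
        ... | inj₂ (_ , inj₂ (_ , z≡y)) = contradiction z≡y z≢y

        shortcut-slope : ∀ {u v l} → Shortcut w R z u v → w' u v ≡ just l → Φ v ℚ.< Φ u ℚ.+ l
        shortcut-slope {u} {v} sc@(_ , step {l = l} _ e (step _ e' (here _)) , _) eq =
          subst (λ l → Φ v ℚ.< Φ u ℚ.+ l) (Maybe.just-injective (trans (≡.sym (new _ _ sc _ _ e e')) eq))
            (+-slopes-<-≤ (Φ u) l (into-z e) (slope≤ _ _ _ e'))

        -- A shortcut would have to be strictly shorter than the edge, whose length is exactly the
        -- rise of `Φ`. Passing through `z` takes strictly more than that rise.
        kept : ∀ {u v l} → w u v ≡ just l → Φ v ≡ Φ u ℚ.+ l → w' u v ≡ just l
        kept {u} {v} {l} e eq = trans (old u v no-shortcut) e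
          where
          no-shortcut : ¬ Shortcut w R z u v
          no-shortcut (d , step {l = l'} u∉ a (step z∉ b (here v∉)) , uniq) =
            ℚ.<-asym (uniq (u ∷ v ∷ []) (l ℚ.+ 0ℚ) (step u∉ e (here v∉)) (λ ()))
              (+-cancelˡ-< (Φ u) (subst (ℚ._< _) (trans eq (cong (Φ u ℚ.+_) (≡.sym (ℚ.+-identityʳ l))))
                (+-slopes-<-≤ (Φ u) l' (into-z a) (walk-slope (step z∉ b (here v∉))))))

      Cert-Step : Cert w' x c y
      Cert-Step = record
        { Φ = Φ ; slope = slope' ; l₁ = l₁ ; l₂ = l₂
        ; e₁ = kept e₁ rise₁ ; e₂ = kept e₂ rise₂ ; rise₁ = rise₁ ; rise₂ = rise₂
        ; Φx<Φc = Φx<Φc ; Φc<Φy = Φc<Φy }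
        where
        Slope : Fin N → Fin N → ℚ → Set
        Slope u v l = Φ v ℚ.< Φ u ℚ.+ l ⊎ (Φ v ≡ Φ u ℚ.+ l × ((u ≡ x × v ≡ c) ⊎ (u ≡ c × v ≡ y)))

        Slope? : ∀ u v l → Dec (Slope u v l)
        Slope? u v l = (Φ v ℚ.<? Φ u ℚ.+ l) ⊎-dec ((Φ v ℚ.≟ Φ u ℚ.+ l) ×-dec
          (((u Fin.≟ x) ×-dec (v Fin.≟ c)) ⊎-dec ((u Fin.≟ c) ×-dec (v Fin.≟ y))))

        -- Whether a shortcut was added is not decidable, but the slope condition is.
        slope' : ∀ u v l → w' u v ≡ just l → Slope u v l
        slope' u v l e = decidable-stable (Slope? u v l) λ ¬s →
          ¬s (slope u v l (trans (≡.sym (old u v (λ sc → ¬s (inj₁ (shortcut-slope sc e))))) e))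

  -- Negating the potential reverses all slopes. Both orientations are wanted because `Step` lists a
  -- shortcut with its smaller endpoint first, and the certificates do not know the order of the
  -- codes.
  Cert-reverse : ∀ {w x c y} → (∀ u v → w u v ≡ w v u) → Cert w x c y → Cert w y c x
  Cert-reverse {w} {x} {c} {y} w-sym C = record
    { Φ = λ v → ℚ.- Φ v ; slope = slope'
    ; l₁ = l₂ ; l₂ = l₁ ; e₁ = trans (w-sym y c) e₂ ; e₂ = trans (w-sym c x) e₁
    ; rise₁ = flip-≡ rise₂ ; rise₂ = flip-≡ rise₁
    ; Φx<Φc = ℚ.neg-antimono-< Φc<Φy ; Φc<Φy = ℚ.neg-antimono-< Φx<Φc }
    where
    open Cert C

    shift : ∀ a b → (ℚ.- a) ℚ.+ b ≡ ℚ.- (a ℚ.+ (ℚ.- b))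
    shift a b = ≡.sym (trans (ℚ.neg-distrib-+ a (ℚ.- b)) (cong ((ℚ.- a) ℚ.+_) (⁻¹-involutive b)))

    cancel : ∀ a l → (a ℚ.+ l) ℚ.+ (ℚ.- l) ≡ a
    cancel a l = trans (ℚ.+-assoc a l (ℚ.- l)) (trans (cong (a ℚ.+_) (ℚ.+-inverseʳ l)) (ℚ.+-identityʳ a))

    flip-≡ : ∀ {a b l} → b ≡ a ℚ.+ l → ℚ.- a ≡ (ℚ.- b) ℚ.+ l
    flip-≡ {a} {b} {l} refl = trans (cong ℚ.-_ (≡.sym (cancel a l))) (≡.sym (shift (a ℚ.+ l) l))

    flip-< : ∀ {a b l} → b ℚ.< a ℚ.+ l → ℚ.- a ℚ.< (ℚ.- b) ℚ.+ l
    flip-< {a} {b} {l} lt = subst (ℚ.- a ℚ.<_) (≡.sym (shift b l))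
      (ℚ.neg-antimono-< (subst (b ℚ.+ (ℚ.- l) ℚ.<_) (cancel a l) (ℚ.+-monoˡ-< (ℚ.- l) lt)))

    slope' : ∀ u v l → w u v ≡ just l → _
    slope' u v l e with slope v u l (trans (w-sym v u) e)
    ... | inj₁ lt                            = inj₁ (flip-< lt)
    ... | inj₂ (eq , inj₁ (v≡x , u≡c)) = inj₂ (flip-≡ eq , inj₂ (u≡c , v≡x))
    ... | inj₂ (eq , inj₂ (v≡c , u≡y)) = inj₂ (flip-≡ eq , inj₁ (u≡y , v≡c))

-- Counting in lists

when : ∀ {P : Set} → Dec P → ℕ → ℕ
when (yes _) n = n
when (no  _) n = 0

when-≤ : ∀ {P : Set} (P? : Dec P) {m n} → (P → m ≤ n) → when P? m ≤ n
when-≤ (yes p) le = le p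
when-≤ (no  _) le = z≤n

when-yes : ∀ {P : Set} (P? : Dec P) {n} → P → when P? n ≡ n
when-yes (yes _) _ = refl
when-yes (no ¬p) p = contradiction p ¬p

module _ {A : Set} where

  lookup-injective : ∀ {xs : List A} → Unique xs → ∀ {i j} → lookup xs i ≡ lookup xs j → i ≡ j
  lookup-injective (_ ∷ _)      {zero}  {zero}  _  = refl
  lookup-injective (x∉xs ∷ _)   {zero}  {suc j} eq = contradiction eq (All.lookup x∉xs (∈-lookup j))
  lookup-injective (x∉xs ∷ _)   {suc i} {zero}  eq = contradiction (≡.sym eq) (All.lookup x∉xs (∈-lookup i))
  lookup-injective (_ ∷ unique) {suc i} {suc j} eq = cong suc (lookup-injective unique eq)

  Unique-⊆-length : ∀ {xs ys : List A} → Unique xs → (∀ {x} → x ∈ xs → x ∈ ys) → length xs ≤ length ys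
  Unique-⊆-length {xs} {ys} unique ⊆ = Fin.injective⇒≤ {f = λ i → Any.index (⊆ (∈-lookup i))} λ {i} {j} eq →
    lookup-injective unique (trans (Any.lookup-index (⊆ (∈-lookup i)))
      (trans (cong (lookup ys) eq) (≡.sym (Any.lookup-index (⊆ (∈-lookup j))))))

  ∑ : List A → (A → ℕ) → ℕ
  ∑ xs f = sum (map f xs)

  ∑-mono : ∀ xs {f g} → (∀ x → f x ≤ g x) → ∑ xs f ≤ ∑ xs g
  ∑-mono []       le = z≤n
  ∑-mono (x ∷ xs) le = ℕ.+-mono-≤ (le x) (∑-mono xs le)

  ∑-+ : ∀ xs f g → ∑ xs (λ x → f x + g x) ≡ ∑ xs f + ∑ xs g
  ∑-+ []       f g = refl
  ∑-+ (x ∷ xs) f g rewrite ∑-+ xs f g =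
    solve 4 (λ a b c d → a :+ b :+ (c :+ d) := a :+ c :+ (b :+ d)) refl (f x) (g x) (∑ xs f) (∑ xs g)
    where open +-*-Solver

  ∑-* : ∀ xs c f → ∑ xs (λ x → c * f x) ≡ c * ∑ xs f
  ∑-* []       c f = ≡.sym (ℕ.*-zeroʳ c)
  ∑-* (x ∷ xs) c f rewrite ∑-* xs c f = ≡.sym (ℕ.*-distribˡ-+ c (f x) (∑ xs f))

  ∑-const : ∀ xs c → ∑ xs (λ _ → c) ≡ length xs * c
  ∑-const []       c = refl
  ∑-const (x ∷ xs) c = cong (c +_) (∑-const xs c)

  -- Made for contractions that touch one address or one label: the whole loss sits in one summand,
  -- and uniqueness makes it paid at most once.
  ∑-≤-except : ∀ {xs f g c} x₀ → Unique xs → (∀ x → x ≢ x₀ → f x ≤ g x) → f x₀ ≤ g x₀ + c →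
               (∀ x → Dec (x ≡ x₀)) → ∑ xs f ≤ ∑ xs g + c
  ∑-≤-except {[]} x₀ _ _ _ _ = z≤n
  ∑-≤-except {x ∷ xs} {f} {g} {c} x₀ (x∉ ∷ unique) le le₀ _≟x₀ with x ≟x₀
  ... | no x≢x₀ = ℕ.≤-trans (ℕ.+-mono-≤ (le x x≢x₀) (∑-≤-except x₀ unique le le₀ _≟x₀))
                    (ℕ.≤-reflexive (≡.sym (ℕ.+-assoc (g x) _ c)))
  ... | yes refl = begin
    f x + ∑ xs f       ≤⟨ ℕ.+-mono-≤ le₀ (rest xs x∉) ⟩
    g x + c + ∑ xs g   ≡⟨ solve 3 (λ a b d → a :+ b :+ d := a :+ d :+ b) refl (g x) c (∑ xs g) ⟩
    g x + ∑ xs g + c   ∎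
    where
    open ℕ.≤-Reasoning
    open +-*-Solver
    rest : ∀ ys → All (x ≢_) ys → ∑ ys f ≤ ∑ ys g
    rest []       []          = z≤n
    rest (y ∷ ys) (x≢y ∷ x≢) = ℕ.+-mono-≤ (le y (≢-sym x≢y)) (rest ys x≢)

  count : {P : A → Set} → Decidable P → List A → ℕ
  count P? xs = length (filter P? xs)

  module _ {P Q : A → Set} (P? : Decidable P) (Q? : Decidable Q) where

    count-mono : ∀ xs → (∀ x → P x → Q x) → count P? xs ≤ count Q? xs
    count-mono []       le = z≤n
    count-mono (x ∷ xs) le with P? x | Q? x
    ... | yes p | yes q = s≤s (count-mono xs le)
    ... | yes p | no ¬q = contradiction (le x p) ¬q
    ... | no ¬p | yes q = ℕ.m≤n⇒m≤1+n (count-mono xs le)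
    ... | no ¬p | no ¬q = count-mono xs le

  module _ {P Q S : A → Set} (P? : Decidable P) (Q? : Decidable Q) (S? : Decidable S) where

    count-⊎ : ∀ xs → (∀ x → P x → Q x ⊎ S x) → count P? xs ≤ count Q? xs + count S? xs
    count-⊎ []       le = z≤n
    count-⊎ (x ∷ xs) le with P? x | Q? x | S? x | count-⊎ xs le
    ... | yes p | yes q | yes s | ih = s≤s (ℕ.≤-trans ih (ℕ.+-monoʳ-≤ _ (ℕ.n≤1+n _)))
    ... | yes p | yes q | no ¬s | ih = s≤s ih
    ... | yes p | no ¬q | yes s | ih = ℕ.≤-trans (s≤s ih) (ℕ.≤-reflexive (≡.sym (ℕ.+-suc _ _)))
    ... | yes p | no ¬q | no ¬s | ih = contradiction (le x p) [ ¬q , ¬s ]′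
    ... | no ¬p | yes q | yes s | ih = ℕ.m≤n⇒m≤1+n (ℕ.≤-trans ih (ℕ.+-monoʳ-≤ _ (ℕ.n≤1+n _)))
    ... | no ¬p | yes q | no ¬s | ih = ℕ.m≤n⇒m≤1+n ih
    ... | no ¬p | no ¬q | yes s | ih = ℕ.≤-trans ih (ℕ.+-monoʳ-≤ _ (ℕ.n≤1+n _))
    ... | no ¬p | no ¬q | no ¬s | ih = ih

  module _ {P : A → Set} (P? : Decidable P) where

    indicator : A → ℕ
    indicator x = when (P? x) 1

    indicator-yes : ∀ {x} → P x → indicator x ≡ 1
    indicator-yes {x} p with P? x
    ... | yes _ = refl
    ... | no ¬p = contradiction p ¬p

    count-∷ : ∀ x xs → count P? (x ∷ xs) ≡ indicator x + count P? xs
    count-∷ x xs with P? x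
    ... | yes _ = refl
    ... | no  _ = refl

    ∑-indicator : ∀ xs → ∑ xs indicator ≡ count P? xs
    ∑-indicator []       = refl
    ∑-indicator (x ∷ xs) with P? x
    ... | yes _ = cong suc (∑-indicator xs)
    ... | no  _ = ∑-indicator xs

  count-++ : ∀ {P : A → Set} (P? : Decidable P) xs ys → count P? (xs ++ ys) ≡ count P? xs + count P? ys
  count-++ P? []       ys = refl
  count-++ P? (x ∷ xs) ys with P? x
  ... | yes _ = cong suc (count-++ P? xs ys)
  ... | no  _ = count-++ P? xs ys

module _ {A B : Set} where

  count-map : ∀ {P : B → Set} (P? : Decidable P) (f : A → B) xs → count P? (map f xs) ≡ count (P? ∘ f) xs
  count-map P? f []       = refl
  count-map P? f (x ∷ xs) with P? (f x)
  ... | yes _ = cong suc (count-map P? f xs)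
  ... | no  _ = count-map P? f xs

module _ {A B : Set} where

  count-cartesianProduct : ∀ {P : A × B → Set} (P? : Decidable P) xs ys →
    count P? (cartesianProduct xs ys) ≡ ∑ xs (λ x → count (λ y → P? (x , y)) ys)
  count-cartesianProduct P? []       ys = refl
  count-cartesianProduct P? (x ∷ xs) ys = trans (count-++ P? (map (x ,_) ys) _)
    (cong₂ _+_ (count-map P? (x ,_) ys) (count-cartesianProduct P? xs ys))

  ∑-map : ∀ (f : A → B) g xs → ∑ (map f xs) g ≡ ∑ xs (g ∘ f)
  ∑-map f g xs = cong sum (≡.sym (List.map-∘ xs))

module _ {A B C : Set} where

  ∑-cartesianProductWith : ∀ (f : A → B → C) g xs ys →
    ∑ (cartesianProductWith f xs ys) g ≡ ∑ xs (λ x → ∑ ys (λ y → g (f x y)))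
  ∑-cartesianProductWith f g []       ys = refl
  ∑-cartesianProductWith f g (x ∷ xs) ys =
    trans (cong sum (List.map-++ g (map (f x) ys) _))
      (trans (sum-++ (map g (map (f x) ys)) _)
        (cong₂ _+_ (∑-map (f x) g ys) (∑-cartesianProductWith f g xs ys)))

  length-cartesianProductWith : ∀ (f : A → B → C) xs ys →
    length (cartesianProductWith f xs ys) ≡ length xs * length ys
  length-cartesianProductWith f []       ys = refl
  length-cartesianProductWith f (x ∷ xs) ys =
    trans (List.length-++ (map (f x) ys)) (cong₂ _+_ (List.length-map (f x) ys) (length-cartesianProductWith f xs ys))

module _ {N : ℕ} {w w' : Weights N} {R v k} (S : Step w R v w' k) where
  open Step S renaming (count to shortcut-count)

  -- The list may contain an edge in both orientations while `Step` counts it once, hence the factor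
  -- 2.
  count-shortcuts : ∀ (xs : List (Fin N × Fin N)) → Unique xs →
    (∀ {u x} → (u , x) ∈ xs → u ≢ x × Shortcut w R v u x × Shortcut w R v x u) →
    length xs ≤ 2 * k
  count-shortcuts xs xs! good = begin
    length xs                                           ≤⟨ Unique-⊆-length xs! covered ⟩
    length (shortcuts ++ map swap shortcuts)            ≡⟨ List.length-++ shortcuts ⟩
    length shortcuts + length (map swap shortcuts)      ≡⟨ cong₂ _+_ shortcut-count (trans (List.length-map swap shortcuts) (trans shortcut-count (≡.sym (ℕ.+-identityʳ k)))) ⟩
    2 * k                                               ∎
    where
    open ℕ.≤-Reasoning
    covered : ∀ {p} → p ∈ xs → p ∈ shortcuts ++ map swap shortcuts
    covered {u , x} p∈ with good p∈
    ... | u≢x , ux , xu with Fin.<-cmp u x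
    ...   | tri< u<x _ _ = ∈-++⁺ˡ (Equivalence.from (spec u x) (u<x , ux))
    ...   | tri≈ _ u≡x _ = contradiction u≡x u≢x
    ...   | tri> _ _ x<u = ∈-++⁺ʳ shortcuts (∈-map⁺ swap (Equivalence.from (spec x u) (x<u , xu)))

-- The cluster tree

par : ℕ → Bool
par zero    = false
par (suc k) = not (par k)

-- An index counts the clusters on the way down from the root; its `height` is that of the branches
-- just below the hubs of that cluster.
height : ∀ {k} → Fin k → ℕ
height {suc k} zero    = k
height {suc k} (suc d) = height d

-- The base is 4 · 16: 4 from the radius `4r` of the balls, 16 from the diameter bound `16 * W k` of
-- a connected piece of height `k`. If `4r` exceeds `W (suc k)`, then `r` exceeds that diameter, so
-- no shortest path of length at least `r` fits into a single branch.
W : ℕ → ℕ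
W k = 64 ^ k

1≤W : ∀ k → 1 ≤ W k
1≤W k = ℕ.m^n>0 64 k

64≤W : ∀ k → 64 ≤ W (suc k)
64≤W k = ℕ.*-monoʳ-≤ 64 (1≤W k)

W<W : ∀ k → W k < W (suc k)
W<W k = ℕ.^-monoʳ-< 64 (s≤s (s≤s z≤n)) (ℕ.n<1+n k)

module Tree (h M : ℕ) where

  data V : ℕ → Set where
    leaf : Fin h → Bool → V 0
    hub  : ∀ {k} → Fin h → V (suc k)
    sub  : ∀ {k} → Fin M → V k → V (suc k)

  sub-injectiveˡ : ∀ {k r s} {u v : V k} → sub r u ≡ sub s v → r ≡ s
  sub-injectiveˡ refl = refl

  sub-injectiveʳ : ∀ {k r s} {u v : V k} → sub r u ≡ sub s v → u ≡ v
  sub-injectiveʳ refl = refl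

  hub-injective : ∀ {k s t} → hub {k} s ≡ hub t → s ≡ t
  hub-injective refl = refl

  _≟ᵥ_ : ∀ {k} (u v : V k) → Dec (u ≡ v)
  leaf s b ≟ᵥ leaf t c = map′ (λ { (refl , refl) → refl }) (λ { refl → refl , refl }) ((s Fin.≟ t) ×-dec (b 𝔹.≟ c))
  hub s ≟ᵥ hub t = map′ (cong hub) hub-injective (s Fin.≟ t)
  hub s ≟ᵥ sub r v = no λ ()
  sub r u ≟ᵥ hub t = no λ ()
  sub r u ≟ᵥ sub s v = map′ (λ { (refl , refl) → refl }) (λ { refl → refl , refl }) ((r Fin.≟ s) ×-dec (u ≟ᵥ v))

  Addr : ℕ → Set
  Addr = Vec (Fin M)

  node : ∀ {k} → Addr k → Fin h → Bool → V k
  node []      t b = leaf t b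
  node (s ∷ a) t b = sub s (node a t b)

  -- Depends only on the coordinates of the address before `d`: addresses with the same hub at `d`
  -- are those that share a cluster.
  hubAt : ∀ {k} → Addr k → Fin k → Fin h → V k
  hubAt (s ∷ a) zero    t = hub t
  hubAt (s ∷ a) (suc d) t = sub s (hubAt a d t)

  nodeInfo : ∀ {k} → V k → Maybe (Fin h × Bool)
  nodeInfo (leaf t b) = just (t , b)
  nodeInfo (hub t)    = nothing
  nodeInfo (sub s v)  = nodeInfo v

  nodeInfo-node : ∀ {k} (a : Addr k) t b → nodeInfo (node a t b) ≡ just (t , b)
  nodeInfo-node []      t b = refl
  nodeInfo-node (s ∷ a) t b = nodeInfo-node a t b

  -- The preference of a hub for its own label. `hub-cert` relies on the penalty for other labels
  -- being positive, `partner-cert` on its being at most 2 and thus negligible against every scale.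
  δ : Fin h → Fin h → ℕ
  δ t t' = if does (t Fin.≟ t') then 0 else 2

  δ-refl : ∀ t → δ t t ≡ 0
  δ-refl t with t Fin.≟ t
  ... | yes _   = refl
  ... | no t≢t = contradiction refl t≢t

  δ≤2 : ∀ t t' → δ t t' ≤ 2
  δ≤2 t t' with t Fin.≟ t'
  ... | yes _ = z≤n
  ... | no  _ = ℕ.≤-refl

  data Edge : ∀ {k} → V k → V k → ℕ → Set where
    pair : ∀ {t b b'} → b' ≡ not b → Edge (leaf t b) (leaf t b') 2
    up   : ∀ {k s t t'} {v : V k} → nodeInfo v ≡ just (t , par k) →
           Edge (sub s v) (hub t') (W (suc k) + δ t t')
    down : ∀ {k s t t'} {v : V k} → nodeInfo v ≡ just (t , par k) →
           Edge (hub t') (sub s v) (W (suc k) + δ t t')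
    inside : ∀ {k s l} {u v : V k} → Edge u v l → Edge (sub s u) (sub s v) l

  Edge-sym : ∀ {k l} {u v : V k} → Edge u v l → Edge v u l
  Edge-sym (pair {b = b} refl) = pair (≡.sym (𝔹.not-involutive b))
  Edge-sym (up i)     = down i
  Edge-sym (down i)   = up i
  Edge-sym (inside e) = inside (Edge-sym e)

  hubLen : ∀ {k} → Fin h → V k → Maybe ℕ
  hubLen {k} t' v with nodeInfo v
  ... | nothing      = nothing
  ... | just (t , b) = if does (b 𝔹.≟ par k) then just (W (suc k) + δ t t') else nothing

  weight : ∀ {k} → V k → V k → Maybe ℕ
  weight (leaf t b) (leaf t' b') = if does ((t' Fin.≟ t) ×-dec (b' 𝔹.≟ not b)) then just 2 else nothing
  weight (hub t)    (hub t')     = nothing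
  weight (hub t)    (sub s v)    = hubLen t v
  weight (sub s v)  (hub t)      = hubLen t v
  weight (sub s u)  (sub s' v)   = if does (s Fin.≟ s') then weight u v else nothing

  hubLen⇒ : ∀ {k t' l} {v : V k} → hubLen t' v ≡ just l →
            ∃[ t ] (nodeInfo v ≡ just (t , par k) × l ≡ W (suc k) + δ t t')
  hubLen⇒ {k} {t'} {l} {v} eq with nodeInfo v
  ... | just (t , b) with b 𝔹.≟ par k
  hubLen⇒ refl | just (t , b) | yes refl = t , refl , refl

  ⇒hubLen : ∀ {k t t'} {v : V k} → nodeInfo v ≡ just (t , par k) → hubLen t' v ≡ just (W (suc k) + δ t t')
  ⇒hubLen {k} {t} {t'} {v} eq with nodeInfo v
  ⇒hubLen {k} refl | just (t , b) with b 𝔹.≟ b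
  ... | yes _ = refl
  ... | no b≢b = contradiction refl b≢b

  weight⇒Edge : ∀ {k l} (u v : V k) → weight u v ≡ just l → Edge u v l
  weight⇒Edge (leaf t b) (leaf t' b') eq with t' Fin.≟ t | b' 𝔹.≟ not b
  weight⇒Edge (leaf t b) (leaf t' b') refl | yes refl | yes b'≡ = pair b'≡
  weight⇒Edge (leaf t b) (leaf t' b') ()   | yes _    | no _
  weight⇒Edge (leaf t b) (leaf t' b') ()   | no _     | _
  weight⇒Edge (hub t) (sub s v) eq with hubLen⇒ {v = v} eq
  ... | _ , i , refl = down i
  weight⇒Edge (sub s v) (hub t) eq with hubLen⇒ {v = v} eq
  ... | _ , i , refl = up i
  weight⇒Edge (sub s u) (sub s' v) eq with s Fin.≟ s'
  ... | yes refl = inside (weight⇒Edge u v eq)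

  Edge⇒weight : ∀ {k l} {u v : V k} → Edge u v l → weight u v ≡ just l
  Edge⇒weight (pair {t} {b} {b'} eq) with t Fin.≟ t | b' 𝔹.≟ not b
  ... | yes _   | yes _  = refl
  ... | yes _   | no ne  = contradiction eq ne
  ... | no t≢t  | _      = contradiction refl t≢t
  Edge⇒weight (up {v = v} i)   = ⇒hubLen {v = v} i
  Edge⇒weight (down {v = v} i) = ⇒hubLen {v = v} i
  Edge⇒weight (inside {s = s} e) with s Fin.≟ s
  ... | yes _   = Edge⇒weight e
  ... | no s≢s = contradiction refl s≢s

  weight-sym : ∀ {k} (u v : V k) → weight u v ≡ weight v u
  weight-sym u v with weight u v in eq | weight v u in eq'
  ... | nothing | nothing = refl
  ... | just l  | _       = trans (≡.sym (Edge⇒weight (Edge-sym (weight⇒Edge u v eq)))) eq'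
  ... | nothing | just l  = trans (≡.sym eq) (Edge⇒weight (Edge-sym (weight⇒Edge v u eq')))

  Edge-irrefl : ∀ {k l} {u : V k} → ¬ Edge u u l
  Edge-irrefl (pair {b = b} eq) = 𝔹.not-¬ {b} refl eq
  Edge-irrefl (inside e)       = Edge-irrefl e

  weight-irrefl : ∀ {k} (u : V k) → weight u u ≡ nothing
  weight-irrefl u with weight u u in eq
  ... | nothing = refl
  ... | just l  = contradiction (weight⇒Edge u u eq) Edge-irrefl

  W≤W+ : ∀ {n} k → n ≤ W k → ∀ {m} → n ≤ W k + m
  W≤W+ k n≤ = ℕ.≤-trans n≤ (ℕ.m≤m+n (W k) _)

  -- The potential of `hub-cert` dips by 1 at one node and peaks by 1 at another; length 2 keeps the
  -- edges around them strict.
  2≤Edge : ∀ {k l} {u v : V k} → Edge u v l → 2 ≤ l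
  2≤Edge (pair _)       = ℕ.≤-refl
  2≤Edge (up {k} _)     = W≤W+ (suc k) (ℕ.≤-trans (s≤s (s≤s z≤n)) (64≤W k))
  2≤Edge (down {k} _)   = W≤W+ (suc k) (ℕ.≤-trans (s≤s (s≤s z≤n)) (64≤W k))
  2≤Edge (inside e)     = 2≤Edge e

  -- Apart from the pair edge, a node is entered only from hubs. The jump in length from 2 to 64 is
  -- what `partner-cert` uses to rule out other tight edges into its pair.
  Edge-into-node : ∀ {k l} {u : V k} (a : Addr k) t b → Edge u (node a t b) l →
                   (u ≡ node a t (not b) × l ≡ 2) ⊎ 64 ≤ l
  Edge-into-node []      t b (pair {b = b'} refl) = inj₁ (cong (leaf t) (≡.sym (𝔹.not-involutive b')) , refl)
  Edge-into-node {suc k} (s ∷ a) t b (down _)    = inj₂ (W≤W+ (suc k) (64≤W k))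
  Edge-into-node (s ∷ a) t b (inside e) with Edge-into-node a t b e
  ... | inj₁ (u≡ , l≡) = inj₁ (cong (sub s) u≡ , l≡)
  ... | inj₂ 64≤l      = inj₂ 64≤l

  -- Certificates in the original tree

  record NCert {k} (x c y : V k) : Set where
    field
      Φ     : V k → ℕ
      slope : ∀ {u v l} → Edge u v l →
              Φ v < Φ u + l ⊎ (Φ v ≡ Φ u + l × ((u ≡ x × v ≡ c) ⊎ (u ≡ c × v ≡ y)))
      l₁ l₂ : ℕ
      e₁    : Edge x c l₁
      e₂    : Edge c y l₂
      rise₁ : Φ c ≡ Φ x + l₁
      rise₂ : Φ y ≡ Φ c + l₂
      -- Allows extending Φ by 0 to an enclosing cluster.
      bound : ∀ v → Φ v < W (suc k)

  lift : ∀ {k} {x c y : V k} s → NCert x c y → NCert (sub s x) (sub s c) (sub s y)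
  lift {k} {x} {c} {y} s C = record
    { Φ = Φ' ; slope = slope' ; l₁ = l₁ ; l₂ = l₂ ; e₁ = inside e₁ ; e₂ = inside e₂
    ; rise₁ = trans (Φ'-s c) (trans rise₁ (cong (_+ l₁) (≡.sym (Φ'-s x))))
    ; rise₂ = trans (Φ'-s y) (trans rise₂ (cong (_+ l₂) (≡.sym (Φ'-s c))))
    ; bound = λ v → ℕ.<-trans (Φ'<W v) (W<W (suc k)) }
    where
    open NCert C
    Φ' : V (suc k) → ℕ
    Φ' (hub _)   = 0
    Φ' (sub r v) = if does (r Fin.≟ s) then Φ v else 0

    Φ'-s : ∀ v → Φ' (sub s v) ≡ Φ v
    Φ'-s v with s Fin.≟ s
    ... | yes _   = refl
    ... | no s≢s = contradiction refl s≢s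

    Φ'<W : ∀ v → Φ' v < W (suc k)
    Φ'<W (hub _) = 1≤W (suc k)
    Φ'<W (sub r v) with r Fin.≟ s
    ... | yes _ = bound v
    ... | no  _ = 1≤W (suc k)

    slope' : ∀ {u v l} → Edge u v l → _
    slope' {u} {v} e@(up _)   = inj₁ (ℕ.<-≤-trans (ℕ.<-≤-trans (s≤s z≤n) (2≤Edge e)) (ℕ.m≤n+m _ (Φ' u)))
    slope' {u} {v} (down _)   = inj₁ (ℕ.<-≤-trans (Φ'<W v) (ℕ.m≤m+n _ _))
    slope' (inside {s = r} e) with r Fin.≟ s
    ... | no  _ = inj₁ (ℕ.<-≤-trans (s≤s z≤n) (2≤Edge e))
    ... | yes refl with slope e
    ...   | inj₁ lt                            = inj₁ lt
    ...   | inj₂ (eq , inj₁ (refl , refl)) = inj₂ (eq , inj₁ (refl , refl))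
    ...   | inj₂ (eq , inj₂ (refl , refl)) = inj₂ (eq , inj₂ (refl , refl))

  module _ {k : ℕ} where

    private
      L P : ℕ
      L = W (suc k)
      P = ℕ.pred L

      L≡1+P : L ≡ suc P
      L≡1+P = ≡.sym (ℕ.suc-pred L ⦃ ℕ.>-nonZero (1≤W (suc k)) ⦄)

      P<L : P < L
      P<L = ℕ.≤-reflexive (≡.sym L≡1+P)

      1≤P : 1 ≤ P
      1≤P = ℕ.s≤s⁻¹ (subst (2 ≤_) L≡1+P (ℕ.≤-trans (s≤s (s≤s z≤n)) (64≤W k)))

      small<64L : ∀ {n} → n ≤ 3 * L → n < W (suc (suc k))
      small<64L n≤ = ℕ.≤-<-trans n≤ (ℕ.*-monoˡ-< L ⦃ ℕ.>-nonZero (1≤W (suc k)) ⦄ {3} {64} (ℕ.m≤m+n 4 60))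

    -- The potential is `L` at all hubs of the cluster. In branch `s` it is 0 at `x` and 1
    -- elsewhere; in branch `s'` it is `2L` at `y` and `2L - 1` elsewhere, as in all remaining
    -- branches. Only `x` and `y` are extreme enough to use the full length of a hub edge, and `δ`
    -- adds slack at every hub other than `t`.
    hub-cert : ∀ {s s'} (a a' : Addr k) t → s ≢ s' →
      NCert (node (s ∷ a) t (par k)) (hub t) (node (s' ∷ a') t (par k))
    hub-cert {s} {s'} a a' t s≢s' = record
      { Φ = Φ ; slope = slope ; l₁ = L + δ t t ; l₂ = L + δ t t
      ; e₁ = up (nodeInfo-node a t (par k)) ; e₂ = down (nodeInfo-node a' t (par k))
      ; rise₁ = trans (≡.sym L+δ≡L) (cong (_+ (L + δ t t)) (≡.sym Φx≡0))
      ; rise₂ = trans Φy≡2L (cong (L +_) (≡.sym L+δ≡L))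
      ; bound = λ v → small<64L (Φ≤3L v) }
      where
      x y : V k
      x = node a t (par k)
      y = node a' t (par k)

      near far : V k → ℕ
      near v = if does (v ≟ᵥ x) then 0 else 1
      far v = if does (v ≟ᵥ y) then L + L else L + P

      Φ : V (suc k) → ℕ
      Φ (hub _)   = L
      Φ (sub r v) = if does (r Fin.≟ s) then near v else (if does (r Fin.≟ s') then far v else L + P)

      L+δ≡L : L + δ t t ≡ L
      L+δ≡L = trans (cong (L +_) (δ-refl t)) (ℕ.+-identityʳ L)

      Φx≡0 : Φ (sub s x) ≡ 0
      Φx≡0 with s Fin.≟ s | x ≟ᵥ x
      ... | yes _ | yes _ = refl
      ... | yes _ | no ne = contradiction refl ne
      ... | no ne | _     = contradiction refl ne

      Φy≡2L : Φ (sub s' y) ≡ L + L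
      Φy≡2L with s' Fin.≟ s | s' Fin.≟ s' | y ≟ᵥ y
      ... | yes e | _     | _     = contradiction (≡.sym e) s≢s'
      ... | no _  | yes _ | yes _ = refl
      ... | no _  | yes _ | no ne = contradiction refl ne
      ... | no _  | no ne | _     = contradiction refl ne

      near≤1 : ∀ v → near v ≤ 1
      near≤1 v with v ≟ᵥ x
      ... | yes _ = z≤n
      ... | no  _ = ℕ.≤-refl

      far≤2L : ∀ v → far v ≤ L + L
      far≤2L v with v ≟ᵥ y
      ... | yes _ = ℕ.≤-refl
      ... | no  _ = ℕ.+-monoʳ-≤ L (ℕ.<⇒≤ P<L)

      L+P≤far : ∀ v → L + P ≤ far v
      L+P≤far v with v ≟ᵥ y
      ... | yes _ = ℕ.+-monoʳ-≤ L (ℕ.<⇒≤ P<L)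
      ... | no  _ = ℕ.≤-refl

      Φ≤2L : ∀ v → Φ v ≤ L + L
      Φ≤2L (hub _) = ℕ.m≤m+n L L
      Φ≤2L (sub r v) with r Fin.≟ s | r Fin.≟ s'
      ... | yes _ | _     = ℕ.≤-trans (near≤1 v) (ℕ.≤-trans (1≤W (suc k)) (ℕ.m≤m+n L L))
      ... | no _  | yes _ = far≤2L v
      ... | no _  | no _  = ℕ.+-monoʳ-≤ L (ℕ.<⇒≤ P<L)

      Φ≤3L : ∀ v → Φ v ≤ 3 * L
      Φ≤3L v = ℕ.≤-trans (Φ≤2L v) (ℕ.+-monoʳ-≤ L (ℕ.m≤m+n L _))

      2L<L+P+l : ∀ {n l} → 2 ≤ l → L + P ≤ n → L + L < n + l
      2L<L+P+l {n} {l} 2≤l le = begin-strict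
        L + L       ≡⟨ cong (L +_) L≡1+P ⟩
        L + suc P   <⟨ ℕ.+-monoʳ-< L (ℕ.n<1+n (suc P)) ⟩
        L + (2 + P) ≡⟨ cong (L +_) (ℕ.+-comm 2 P) ⟩
        L + (P + 2) ≡⟨ ℕ.+-assoc L P 2 ⟨
        L + P + 2   ≤⟨ ℕ.+-mono-≤ le 2≤l ⟩
        n + l       ∎
        where open ℕ.≤-Reasoning

      slope : ∀ {u v l} → Edge u v l →
        Φ v < Φ u + l ⊎ (Φ v ≡ Φ u + l × ((u ≡ sub s x × v ≡ hub t) ⊎ (u ≡ hub t × v ≡ sub s' y)))
      slope (inside {s = r} {u = u} {v = v} e) with r Fin.≟ s | r Fin.≟ s'
      ... | yes _ | _     = inj₁ (ℕ.<-≤-trans (ℕ.≤-<-trans (near≤1 v) (2≤Edge e)) (ℕ.m≤n+m _ (near u)))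
      ... | no _  | yes _ = inj₁ (ℕ.≤-<-trans (far≤2L v) (2L<L+P+l (2≤Edge e) (L+P≤far u)))
      ... | no _  | no _  = inj₁ (ℕ.m<m+n (L + P) (ℕ.<-≤-trans (s≤s z≤n) (2≤Edge e)))
      slope (up {s = r} {t = q} {t' = t'} {v = u} i) with r Fin.≟ s | r Fin.≟ s' | u ≟ᵥ x
      ... | yes refl | _ | yes refl with trans (≡.sym i) (nodeInfo-node a t (par k))
      ...   | refl with t Fin.≟ t'
      ...     | yes refl = inj₂ (≡.sym (ℕ.+-identityʳ L) , inj₁ (refl , refl))
      ...     | no _     = inj₁ (ℕ.m<m+n L (s≤s z≤n))
      slope (up i) | yes _ | _ | no _ = inj₁ (s≤s (ℕ.m≤m+n L _))
      slope (up {v = u} i) | no _ | yes _ | _ =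
        inj₁ (ℕ.<-≤-trans (ℕ.m<n+m L (ℕ.<-≤-trans (ℕ.<-≤-trans 1≤P (ℕ.m≤n+m P L)) (L+P≤far u)))
               (ℕ.+-monoʳ-≤ (far u) (ℕ.m≤m+n L _)))
      slope (up i) | no _ | no _ | _ =
        inj₁ (ℕ.<-≤-trans (ℕ.m<n+m L (ℕ.<-≤-trans 1≤P (ℕ.m≤n+m P L)))
               (ℕ.+-monoʳ-≤ (L + P) (ℕ.m≤m+n L _)))
      slope (down {s = r} {t = q} {t' = t'} {v = v} i) with r Fin.≟ s | r Fin.≟ s' | v ≟ᵥ y
      ... | yes _ | _ | _ =
        inj₁ (ℕ.≤-<-trans (near≤1 v) (ℕ.<-≤-trans (ℕ.≤-trans (s≤s (s≤s z≤n)) (64≤W k)) (ℕ.m≤m+n L _)))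
      ... | no _ | no _ | _ = inj₁ (ℕ.+-monoʳ-< L (ℕ.<-≤-trans P<L (ℕ.m≤m+n L _)))
      ... | no _ | yes _ | no _ = inj₁ (ℕ.+-monoʳ-< L (ℕ.<-≤-trans P<L (ℕ.m≤m+n L _)))
      ... | no _ | yes refl | yes refl with trans (≡.sym i) (nodeInfo-node a' t (par k))
      ...   | refl with t Fin.≟ t'
      ...     | yes refl = inj₂ (cong (L +_) (≡.sym (ℕ.+-identityʳ L)) , inj₂ (refl , refl))
      ...     | no _     = inj₁ (ℕ.+-monoʳ-< L (ℕ.m<m+n L (s≤s z≤n)))

    -- The potential is 0 at `hub t'`, `L` at the other hubs of the cluster, `ℓ` at `x`, `ℓ + 2` at
    -- `y`, and `L - 1` at everything else below. Being 1 short of `L` makes all other edges out of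
    -- `hub t'` slack.
    partner-cert : ∀ s (a : Addr k) t t' →
      NCert (hub t') (node (s ∷ a) t (par k)) (node (s ∷ a) t (not (par k)))
    partner-cert s a t t' = record
      { Φ = Φ ; slope = slope ; l₁ = ℓ ; l₂ = 2
      ; e₁ = down (nodeInfo-node a t (par k)) ; e₂ = partner-edge (s ∷ a)
      ; rise₁ = trans Φx≡ℓ (cong (_+ ℓ) (≡.sym Φhub≡0))
      ; rise₂ = trans Φy≡ℓ+2 (cong (_+ 2) (≡.sym Φx≡ℓ))
      ; bound = λ v → small<64L (Φ≤3L v) }
      where
      x y : V k
      x = node a t (par k)
      y = node a t (not (par k))

      x≢y : x ≢ y
      x≢y eq with trans (≡.sym (nodeInfo-node a t (par k))) (trans (cong nodeInfo eq) (nodeInfo-node a t (not (par k))))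
      ... | e = 𝔹.not-¬ {par k} refl (Product.,-injectiveʳ (Maybe.just-injective e))

      partner-edge : ∀ {j} (a : Addr j) {b} → Edge (node a t b) (node a t (not b)) 2
      partner-edge []      = pair refl
      partner-edge (s ∷ a) = inside (partner-edge a)

      ℓ : ℕ
      ℓ = L + δ t t'

      near : V k → ℕ
      near v = if does (v ≟ᵥ x) then ℓ else (if does (v ≟ᵥ y) then ℓ + 2 else P)

      Φ : V (suc k) → ℕ
      Φ (hub q)   = if does (q Fin.≟ t') then 0 else L
      Φ (sub r v) = if does (r Fin.≟ s) then near v else P

      Φhub≡0 : Φ (hub t') ≡ 0
      Φhub≡0 with t' Fin.≟ t'
      ... | yes _ = refl
      ... | no ne = contradiction refl ne

      near-x : near x ≡ ℓ
      near-x with x ≟ᵥ x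
      ... | yes _ = refl
      ... | no ne = contradiction refl ne

      near-y : near y ≡ ℓ + 2
      near-y with y ≟ᵥ x | y ≟ᵥ y
      ... | yes e | _     = contradiction (≡.sym e) x≢y
      ... | no _  | yes _ = refl
      ... | no _  | no ne = contradiction refl ne

      Φ-s : ∀ v → Φ (sub s v) ≡ near v
      Φ-s v with s Fin.≟ s
      ... | yes _ = refl
      ... | no ne = contradiction refl ne

      Φx≡ℓ : Φ (sub s x) ≡ ℓ
      Φx≡ℓ = trans (Φ-s x) near-x

      Φy≡ℓ+2 : Φ (sub s y) ≡ ℓ + 2
      Φy≡ℓ+2 = trans (Φ-s y) near-y

      P≤ℓ : P ≤ ℓ
      P≤ℓ = ℕ.≤-trans (ℕ.<⇒≤ P<L) (ℕ.m≤m+n L _)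

      P≤near : ∀ v → P ≤ near v
      P≤near v with v ≟ᵥ x | v ≟ᵥ y
      ... | yes _ | _     = P≤ℓ
      ... | no _  | yes _ = ℕ.≤-trans P≤ℓ (ℕ.m≤m+n ℓ 2)
      ... | no _  | no _  = ℕ.≤-refl

      near≤ℓ+2 : ∀ v → near v ≤ ℓ + 2
      near≤ℓ+2 v with v ≟ᵥ x | v ≟ᵥ y
      ... | yes _ | _     = ℕ.m≤m+n ℓ 2
      ... | no _  | yes _ = ℕ.≤-refl
      ... | no _  | no _  = ℕ.≤-trans P≤ℓ (ℕ.m≤m+n ℓ 2)

      P≤Φsub : ∀ r v → P ≤ Φ (sub r v)
      P≤Φsub r v with r Fin.≟ s
      ... | yes _ = P≤near v
      ... | no  _ = ℕ.≤-refl

      ℓ+2≤L+4 : ℓ + 2 ≤ L + 4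
      ℓ+2≤L+4 = ℕ.≤-trans (ℕ.≤-reflexive (ℕ.+-assoc L _ 2)) (ℕ.+-monoʳ-≤ L (ℕ.+-monoˡ-≤ 2 (δ≤2 t t')))

      -- Handles the hubs of lower clusters that are adjacent to the pair: they sit at `L - 1`, and
      -- their edges of length at least 64 overshoot the peak, which is at most `L + 4`.
      ℓ+2<P+64 : ∀ {n l} → P ≤ n → 64 ≤ l → ℓ + 2 < n + l
      ℓ+2<P+64 {n} {l} P≤n 64≤l = begin-strict
        ℓ + 2       ≤⟨ ℓ+2≤L+4 ⟩
        L + 4       ≡⟨ cong (_+ 4) L≡1+P ⟩
        suc P + 4   ≡⟨ ℕ.+-suc P 4 ⟨
        P + 5       <⟨ ℕ.+-monoʳ-< P (ℕ.m≤m+n 6 58) ⟩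
        P + 64      ≤⟨ ℕ.+-mono-≤ P≤n 64≤l ⟩
        n + l       ∎
        where open ℕ.≤-Reasoning

      4≤L : 4 ≤ L
      4≤L = ℕ.≤-trans (ℕ.m≤m+n 4 60) (64≤W k)

      ℓ+2≤2L : ℓ + 2 ≤ L + L
      ℓ+2≤2L = ℕ.≤-trans ℓ+2≤L+4 (ℕ.+-monoʳ-≤ L 4≤L)

      Φ≤2L : ∀ v → Φ v ≤ L + L
      Φ≤2L (hub q) with q Fin.≟ t'
      ... | yes _ = z≤n
      ... | no  _ = ℕ.m≤m+n L L
      Φ≤2L (sub r v) with r Fin.≟ s
      ... | yes _ = ℕ.≤-trans (near≤ℓ+2 v) ℓ+2≤2L
      ... | no  _ = ℕ.≤-trans (ℕ.<⇒≤ P<L) (ℕ.m≤m+n L L)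

      Φ≤3L : ∀ v → Φ v ≤ 3 * L
      Φ≤3L v = ℕ.≤-trans (Φ≤2L v) (ℕ.+-monoʳ-≤ L (ℕ.m≤m+n L _))

      Φhub≤L : ∀ q → Φ (hub q) ≤ L
      Φhub≤L q with q Fin.≟ t'
      ... | yes _ = z≤n
      ... | no  _ = ℕ.≤-refl

      Slope : V (suc k) → V (suc k) → ℕ → Set
      Slope u v l =
        Φ v < Φ u + l ⊎ (Φ v ≡ Φ u + l × ((u ≡ hub t' × v ≡ sub s x) ⊎ (u ≡ sub s x × v ≡ sub s y)))

      near-other : ∀ {v} → v ≢ x → v ≢ y → near v ≡ P
      near-other {v} v≢x v≢y with v ≟ᵥ x | v ≟ᵥ y
      ... | yes e | _     = contradiction e v≢x
      ... | no _  | yes e = contradiction e v≢y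
      ... | no _  | no _  = refl

      near-slope : ∀ {u v l} → Edge u v l → near v < near u + l ⊎ (near v ≡ near u + l × (u ≡ x × v ≡ y))
      near-slope {u} {v} {l} e = case v ≟ᵥ x of λ where
        (yes refl) → inj₁ (case Edge-into-node a t (par k) e of λ where
          (inj₁ (refl , refl)) → subst₂ _<_ (≡.sym near-x) (cong (_+ 2) (≡.sym near-y))
                                   (ℕ.<-≤-trans (ℕ.m<m+n ℓ (s≤s z≤n)) (ℕ.m≤m+n (ℓ + 2) 2))
          (inj₂ 64≤l) → ℕ.≤-<-trans (near≤ℓ+2 x) (ℓ+2<P+64 (P≤near u) 64≤l))
        (no v≢x) → case v ≟ᵥ y of λ where
          (yes refl) → case Edge-into-node a t (not (par k)) e of λ where
            (inj₁ (u≡ , refl)) → let u≡x = trans u≡ (cong (node a t) (𝔹.not-involutive (par k))) in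
              inj₂ (trans near-y (cong (_+ 2) (trans (≡.sym near-x) (cong near (≡.sym u≡x)))) , u≡x , refl)
            (inj₂ 64≤l) → inj₁ (ℕ.≤-<-trans (near≤ℓ+2 y) (ℓ+2<P+64 (P≤near u) 64≤l))
          (no v≢y) → inj₁ (subst (_< near u + l) (≡.sym (near-other v≢x v≢y))
            (ℕ.≤-<-trans (P≤near u) (ℕ.m<m+n (near u) (ℕ.<-≤-trans (s≤s z≤n) (2≤Edge e)))))

      slope : ∀ {u v l} → Edge u v l → Slope u v l
      slope (inside {s = r} {u = u} {v = v} e) with r Fin.≟ s
      ... | no _ = inj₁ (ℕ.m<m+n P (ℕ.<-≤-trans (s≤s z≤n) (2≤Edge e)))
      ... | yes refl with near-slope e
      ...   | inj₁ lt                  = inj₁ lt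
      ...   | inj₂ (eq , refl , refl) = inj₂ (eq , inj₂ (refl , refl))
      slope (up {s = r} {t' = q} {v = u} i) =
        inj₁ (ℕ.≤-<-trans (Φhub≤L q) (ℕ.<-≤-trans (ℕ.m<n+m L (ℕ.<-≤-trans 1≤P (P≤Φsub r u)))
               (ℕ.+-monoʳ-≤ (Φ (sub r u)) (ℕ.m≤m+n L _))))
      slope (down {s = r} {t = q} {t' = t''} {v = v} i) with r Fin.≟ s | v ≟ᵥ x | v ≟ᵥ y
      ... | no _ | _ | _ = inj₁ (ℕ.<-≤-trans P<L (ℕ.≤-trans (ℕ.m≤m+n L _) (ℕ.m≤n+m _ (Φ (hub t'')))))
      ... | yes _ | no _ | no _ = inj₁ (ℕ.<-≤-trans P<L (ℕ.≤-trans (ℕ.m≤m+n L _) (ℕ.m≤n+m _ (Φ (hub t'')))))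
      -- Here the parities do their work: the partner has the wrong parity for this cluster, so no
      -- edge from its hubs bypasses `x`.
      ... | yes _ | no _ | yes refl =
        contradiction (Product.,-injectiveʳ (Maybe.just-injective (trans (≡.sym i) (nodeInfo-node a t (not (par k))))))
          (𝔹.not-¬ {par k} refl)
      ... | yes refl | yes refl | _ with trans (≡.sym i) (nodeInfo-node a t (par k))
      ...   | refl with t'' Fin.≟ t'
      ...     | yes refl = inj₂ (refl , inj₁ (refl , refl))
      ...     | no _     = inj₁ (ℕ.+-monoʳ-< L (ℕ.<-≤-trans (ℕ.≤-<-trans (δ≤2 t t') (ℕ.<-≤-trans (s≤s (s≤s (s≤s z≤n))) 4≤L)) (ℕ.m≤m+n L _)))

  -- The equation puts both addresses below the same cluster, the inequality into different branches
  -- of it.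
  NCert-hub : ∀ {k} (a a' : Addr k) d t → hubAt a d t ≡ hubAt a' d t → Vec.lookup a d ≢ Vec.lookup a' d →
    NCert (node a t (par (height d))) (hubAt a d t) (node a' t (par (height d)))
  NCert-hub (s ∷ a) (s' ∷ a') zero    t _  s≢s' = hub-cert a a' t s≢s'
  NCert-hub (s ∷ a) (s' ∷ a') (suc d) t eq ne with sub-injectiveˡ eq
  ... | refl = lift s (NCert-hub a a' d t (sub-injectiveʳ eq) ne)

  NCert-partner : ∀ {k} (a : Addr k) d t t' →
    NCert (hubAt a d t') (node a t (par (height d))) (node a t (not (par (height d))))
  NCert-partner (s ∷ a) zero    t t' = partner-cert s a t t'
  NCert-partner (s ∷ a) (suc d) t t' = lift s (NCert-partner a d t t')

-- Paths and diameters of clusters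

module Paths (h M : ℕ) (t₀ : Fin h) (s₀ : Fin M) where

  open Tree h M

  data Path {k} : V k → V k → List (V k) → ℕ → Set where
    here : ∀ {u} → Path u u (u ∷ []) 0
    step : ∀ {u x v xs l n} → Edge u x l → Path x v xs n → Path u v (u ∷ xs) (l + n)

  Reach : ∀ {k} → V k → V k → ℕ → Set
  Reach u v n = ∃[ p ] ∃[ m ] (Path u v p m × m ≤ n)

  Reach-mono : ∀ {k m n} {u v : V k} → m ≤ n → Reach u v m → Reach u v n
  Reach-mono m≤n (p , i , P , i≤m) = p , i , P , ℕ.≤-trans i≤m m≤n

  Reach-refl : ∀ {k n} {u : V k} → Reach u u n
  Reach-refl = _ , _ , here , z≤n

  Reach-edge : ∀ {k l} {u v : V k} → Edge u v l → Reach u v l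
  Reach-edge {l = l} e = _ , _ , step e here , ℕ.≤-reflexive (ℕ.+-identityʳ l)

  Path-++ : ∀ {k m n p q} {u v x : V k} → Path u v p m → Path v x q n → ∃[ r ] Path u x r (m + n)
  Path-++ here Q = _ , Q
  Path-++ {x = x} (step {u} {l = l} e P) Q with Path-++ P Q
  ... | r , PQ = u ∷ r , subst (Path u x (u ∷ r)) (≡.sym (ℕ.+-assoc l _ _)) (step e PQ)

  Path-sym : ∀ {k n p} {u v : V k} → Path u v p n → ∃[ q ] Path v u q n
  Path-sym here = _ , here
  Path-sym {v = v} (step {u} {l = l} {n = n} e P) with Path-sym P
  ... | q , Q with Path-++ Q (step (Edge-sym e) here)
  ...   | r , QE = r , subst (Path v u r) (trans (cong (n +_) (ℕ.+-identityʳ l)) (ℕ.+-comm n l)) QE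

  Reach-trans : ∀ {k m n} {u v x : V k} → Reach u v m → Reach v x n → Reach u x (m + n)
  Reach-trans (_ , _ , P , le) (_ , _ , Q , le') =
    _ , _ , Path-++ P Q .proj₂ , ℕ.+-mono-≤ le le'

  Reach-sym : ∀ {k n} {u v : V k} → Reach u v n → Reach v u n
  Reach-sym (_ , _ , P , le) = _ , _ , Path-sym P .proj₂ , le

  Path-sub : ∀ {k n p} {u v : V k} s → Path u v p n → Path (sub s u) (sub s v) (map (sub s) p) n
  Path-sub s here       = here
  Path-sub s (step e P) = step (inside e) (Path-sub s P)

  Reach-sub : ∀ {k n} {u v : V k} s → Reach u v n → Reach (sub s u) (sub s v) n
  Reach-sub s (_ , _ , P , le) = _ , _ , Path-sub s P , le

  partner : ∀ {k t b} (v : V k) → nodeInfo v ≡ just (t , b) →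
            ∃[ v' ] (nodeInfo v' ≡ just (t , not b) × Edge v v' 2)
  partner (leaf t b) refl = leaf t (not b) , refl , pair refl
  partner (sub s v)  i with partner v i
  ... | v' , i' , e = sub s v' , i' , inside e

  some-node : ∀ {k} b → ∃[ v ] (nodeInfo {k} v ≡ just (t₀ , b))
  some-node {k} b = node (Vec.replicate k s₀) t₀ b , nodeInfo-node (Vec.replicate k s₀) t₀ b

  fix-parity : ∀ {k t c n} {u v : V k} b → nodeInfo v ≡ just (t , c) → Reach u v n →
               ∃[ v' ] (nodeInfo v' ≡ just (t , b) × Reach u v' (n + 2))
  fix-parity {c = c} {n = n} {v = v} b i R with b 𝔹.≟ c
  ... | yes refl = v , i , Reach-mono (ℕ.m≤m+n n 2) R
  ... | no b≢c with partner v i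
  ...   | v' , i' , e = v' , trans i' (cong (λ z → just (_ , z)) (≡.sym (𝔹.¬-not b≢c))) , Reach-trans R (Reach-edge e)

  -- The 4 leaves room for the penalty `δ` and for one pair edge that switches to the wanted parity.
  to-node : ∀ {k} (v : V k) b → ∃[ t ] ∃[ v' ] (nodeInfo v' ≡ just (t , b) × Reach v v' (W k + 4))
  to-node (leaf t c) b with fix-parity {n = 3} b refl (Reach-refl {u = leaf t c})
  ... | v' , i , R = t , v' , i , R
  to-node (hub {k} t) b with some-node {k} (par k)
  ... | v , i with fix-parity {v = sub s₀ v} b i (Reach-mono (ℕ.+-monoʳ-≤ (W (suc k)) (δ≤2 t₀ t)) (Reach-edge (down {t' = t} i)))
  ...   | v' , i' , R = t₀ , v' , i' , subst (Reach _ v') (ℕ.+-assoc (W (suc k)) 2 2) R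
  to-node (sub {k} s v) b with to-node v b
  ... | t , v' , i , R = t , sub s v' , i , Reach-mono (ℕ.+-monoˡ-≤ 4 (ℕ.<⇒≤ (W<W k))) (Reach-sub s R)

  to-hub : ∀ {k} (v : V (suc k)) t → Reach v (hub t) ((W (suc k) + 4) + (W (suc k) + 2))
  to-hub {k} v t with to-node v (par k)
  ... | q , sub s v' , i , R =
    Reach-trans R (Reach-mono (ℕ.+-monoʳ-≤ (W (suc k)) (δ≤2 q t)) (Reach-edge (up i)))

  diameter : ∀ {k} (u v : V (suc k)) → Reach u v (16 * W (suc k))
  diameter {k} u v = Reach-mono le (Reach-trans (to-hub u t₀) (Reach-sym (to-hub v t₀)))
    where
    open ℕ.≤-Reasoning
    open +-*-Solver
    x = W (suc k)
    le : ((x + 4) + (x + 2)) + ((x + 4) + (x + 2)) ≤ 16 * x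
    le = begin
      ((x + 4) + (x + 2)) + ((x + 4) + (x + 2))
        ≡⟨ solve 1 (λ x → ((x :+ con 4) :+ (x :+ con 2)) :+ ((x :+ con 4) :+ (x :+ con 2)) := con 4 :* x :+ con 12 :* con 1) refl x ⟩
      4 * x + 12 * 1  ≤⟨ ℕ.+-monoʳ-≤ (4 * x) (ℕ.*-monoʳ-≤ 12 (1≤W (suc k))) ⟩
      4 * x + 12 * x  ≡⟨ ℕ.*-distribʳ-+ x 4 12 ⟨
      16 * x          ∎

  Path-leaf : ∀ {t t' b b' p n} → Path (leaf t b) (leaf t' b') p n → t ≡ t'
  Path-leaf here              = refl
  Path-leaf (step (pair _) P) = Path-leaf P

  leaf-diameter : ∀ t b b' → Reach (leaf t b) (leaf t b') 2
  leaf-diameter t b b' with b' 𝔹.≟ b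
  ... | yes refl = Reach-refl
  ... | no b'≢b  = Reach-edge (pair (𝔹.¬-not b'≢b))

  -- At height 0 the pairs of different labels are disconnected, so connectedness has to come from a
  -- given path; from height 1 on the hubs join all labels.
  component-diameter : ∀ {k p n} {u v : V k} → Path u v p n → Reach u v (16 * W k)
  component-diameter {zero} {u = leaf t b} {v = leaf t' b'} P with Path-leaf P
  ... | refl = Reach-mono (s≤s (s≤s z≤n)) (leaf-diameter t b b')
  component-diameter {suc k} {u = u} {v = v} _ = diameter u v

  IsHub : ∀ {k} → V (suc k) → Set
  IsHub v = ∃[ t ] (v ≡ hub t)

  data Descended {k} (u v : V (suc k)) (p : List (V (suc k))) (n : ℕ) : Set where
    descended : ∀ s {u' v' p'} → u ≡ sub s u' → v ≡ sub s v' → p ≡ map (sub s) p' → Path u' v' p' n → Descended u v p n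

  -- Distinct branches of a cluster are joined only through its hubs.
  descend : ∀ {k n p} {u v : V (suc k)} → Path u v p n → Any IsHub p ⊎ Descended u v p n
  descend {u = hub t}   here         = inj₁ (here (t , refl))
  descend {u = sub s u} here         = inj₂ (descended s refl refl refl here)
  descend {u = hub t}   (step e P)   = inj₁ (here (t , refl))
  descend {u = sub s u} (step e P) with descend P
  ... | inj₁ any = inj₁ (there any)
  descend {u = sub s u} (step (inside e) P) | inj₂ (descended s refl refl refl P') =
    inj₂ (descended s refl refl refl (step e P'))

  -- Every edge at a hub of this cluster already has length at least `W (suc k)`.
  short-descend : ∀ {k n p} {u v : V (suc k)} → Path u v p n → n < W (suc k) →
                  (∃[ t ] (u ≡ hub t × v ≡ hub t)) ⊎ Descended u v p n
  short-descend {u = hub t}   here _ = inj₁ (t , refl , refl)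
  short-descend {u = sub s u} here _ = inj₂ (descended s refl refl refl here)
  short-descend (step (up _) P)   lt = contradiction (ℕ.≤-trans (ℕ.m≤m+n _ _) (ℕ.m≤m+n _ _)) (ℕ.<⇒≱ lt)
  short-descend (step (down _) P) lt = contradiction (ℕ.≤-trans (ℕ.m≤m+n _ _) (ℕ.m≤m+n _ _)) (ℕ.<⇒≱ lt)
  short-descend (step {l = l} (inside e) P) lt with short-descend P (ℕ.≤-<-trans (ℕ.m≤n+m _ l) lt)
  ... | inj₁ (_ , () , _)
  ... | inj₂ (descended s refl refl refl P') = inj₂ (descended s refl refl refl (step e P'))

  -- Covering the long shortest paths of a ball

  IsShortest : ∀ {k} → V k → V k → List (V k) → ℕ → Set
  IsShortest u v p n = Path u v p n × (∀ q m → Path u v q m → n ≤ m)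

  -- Long n and Near n stand for r ≤ n and n < 4r.
  module Cover
    (Long Near : ℕ → Set) (Near? : Decidable Near)
    (Near-down : ∀ {m n} → m ≤ n → Near n → Near m)
    (gap : ∀ m {n} → n ≤ 16 * m → Long n → ¬ Near (4 * (16 * m)))
    (¬Long-0 : ¬ Long 0) where

    Ball : ∀ {k} → V k → V k → Set
    Ball c y = ∃[ q ] ∃[ m ] (Path y c q m × Near m)

    Covers : ∀ {k} → V k → List (V k) → Set
    Covers c H = ∀ u x p n → IsShortest u x p n → Long n → All (Ball c) p → Any (_∈ H) p

    path-head : ∀ {k p n} {A : V k → Set} {u v : V k} → Path u v p n → All A p → A u
    path-head here       (a ∷ _) = a
    path-head (step _ _) (a ∷ _) = a

    -- A path of positive length in a component of two vertices visits both, so the centre of the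
    -- ball lies on it.
    cover-leaf : ∀ c → Covers {0} c (c ∷ [])
    cover-leaf c u .u _ _ (here , _) long _ = contradiction long ¬Long-0
    cover-leaf (leaf t b) (leaf t' b') x _ _ (step (pair {b' = b''} eq) P , _) _ ((_ , _ , Q , _) ∷ _)
      with Path-leaf Q | b' 𝔹.≟ b
    ... | refl | yes refl = here (here refl)
    ... | refl | no b'≢b with trans (cong not (𝔹.¬-not b'≢b)) (𝔹.not-involutive b)
    ...   | not-b'≡b with P
    ...     | here     = there (here (here (cong (leaf t) (trans eq not-b'≡b))))
    ...     | step _ _ = there (here (here (cong (leaf t) (trans eq not-b'≡b))))

    module _ {k : ℕ} where

      -- A path avoiding the hubs stays in one branch. Being shortest, it is no longer than the
      -- diameter of its component there, and `gap` says that such a length falls below `r`.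
      cover-near : ∀ c → Near (W (suc k)) → Covers {suc k} c (map hub (allFin h))
      cover-near c near u x p n (P , shortest) long _ with descend P
      ... | inj₁ any = Any.map (λ { (t , refl) → ∈-map⁺ hub (∈-allFin t) }) any
      ... | inj₂ (descended s refl refl refl P') with Reach-sub s (component-diameter P')
      ...   | q , m , Q , m≤ = contradiction (Near-down (ℕ.≤-reflexive (≡.sym (ℕ.*-assoc 4 16 (W k)))) near)
                             (gap (W k) (ℕ.≤-trans (shortest q m Q) m≤) long)

      near<W : ¬ Near (W (suc k)) → ∀ {m} → Near m → m < W (suc k)
      near<W far near = ℕ.≰⇒> (λ le → far (Near-down le near))

      -- The radius does not exceed the shortest edge at the centre, so the ball is the centre alone
      -- and contains no path of positive length.
      cover-hub : ¬ Near (W (suc k)) → ∀ t → Covers {suc k} (hub t) []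
      cover-hub far t u .u _ _ (here , _) long _ = contradiction long ¬Long-0
      cover-hub far t u x _ _ (step e P , _) long ((_ , _ , Q , near) ∷ balls)
        with short-descend Q (near<W far near)
      ... | inj₂ (descended _ _ () _ _)
      cover-hub far t .(hub _) x _ _ (step (down _) P , _) long (_ ∷ balls)
          | inj₁ (_ , refl , _) with path-head P balls
      ... | _ , _ , Q' , near' with short-descend Q' (near<W far near')
      ...   | inj₁ (_ , () , _)
      ...   | inj₂ (descended _ _ () _ _)

      ball-sub : ¬ Near (W (suc k)) → ∀ {s} {c : V k} {y} → Ball (sub s c) y → ∃[ y' ] (y ≡ sub s y' × Ball c y')
      ball-sub far (_ , m , Q , near) with short-descend Q (near<W far near)
      ... | inj₁ (_ , _ , ())
      ... | inj₂ (descended s refl refl _ Q') = _ , refl , _ , m , Q' , near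

      -- The ball cannot reach a hub of this cluster and stays in branch `s`. A path in it that is
      -- shortest in the cluster is also shortest in the branch, where there are fewer competitors.
      cover-sub : ¬ Near (W (suc k)) → ∀ s {c : V k} {H} → Covers c H → Covers (sub s c) (map (sub s) H)
      cover-sub far s cov u x p n (P , shortest) long balls with descend P
      ... | inj₁ any with All.lookupAny balls any
      ...   | ball , (_ , is-hub) with ball-sub far ball
      ...     | _ , is-sub , _ = case trans (≡.sym is-hub) is-sub of λ ()
      cover-sub far s cov u x p n (P , shortest) long balls
          | inj₂ (descended s' {p' = p'} refl refl refl P') with ball-sub far (path-head P balls)
      ... | _ , refl , _ = Any.map⁺ (Any.map (∈-map⁺ (sub s)) (cov _ _ p' n
        (P' , λ q m Q → shortest _ m (Path-sub s Q)) long (All.map unsub (All.map⁻ balls))))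
        where
        unsub : ∀ {y} → Ball (sub s _) (sub s y) → Ball _ y
        unsub ball with ball-sub far ball
        ... | _ , refl , ball' = ball'

    cover : ∀ {k} (c : V k) → ∃[ H ] (length H ≤ h × Covers c H)
    cover {zero} c = c ∷ [] , ℕ.≤-trans (s≤s z≤n) (Fin.toℕ<n t₀) , cover-leaf c
    cover {suc k} c with Near? (W (suc k))
    ... | yes near = map hub (allFin h) , ℕ.≤-reflexive (trans (List.length-map hub (allFin h)) (List.length-tabulate {n = h} id)) , cover-near {k} c near
    cover {suc k} (hub t)   | no far = [] , z≤n , cover-hub {k} far t
    cover {suc k} (sub s c) | no far with cover c
    ... | H , len≤ , cov = map (sub s) H , ℕ.≤-trans (ℕ.≤-reflexive (List.length-map (sub s) H)) len≤ , cover-sub {k} far s cov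

-- Highway dimension and diameter

module Network (h M : ℕ) (t₀ : Fin h) (s₀ : Fin M) (k : ℕ) where

  open Tree h M
  open Paths h M t₀ s₀

  leaves : List (V 0)
  leaves = cartesianProductWith leaf (allFin h) (true ∷ false ∷ [])

  vertices : ∀ j → List (V j)
  vertices zero    = leaves
  vertices (suc j) = map hub (allFin h) ++ cartesianProductWith sub (allFin M) (vertices j)

  ∈-vertices : ∀ {j} (v : V j) → v ∈ vertices j
  ∈-vertices (leaf t b) = ∈-cartesianProductWith⁺ leaf (∈-allFin t) (∈-bools b)
    where
    ∈-bools : ∀ b → b ∈ true ∷ false ∷ []
    ∈-bools true  = here refl
    ∈-bools false = there (here refl)
  ∈-vertices (hub t)   = ∈-++⁺ˡ (∈-map⁺ hub (∈-allFin t))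
  ∈-vertices (sub s v) = ∈-++⁺ʳ _ (∈-cartesianProductWith⁺ sub (∈-allFin s) (∈-vertices v))

  vertices-unique : ∀ j → Unique (vertices j)
  vertices-unique zero = Unique.cartesianProductWith⁺ leaf (λ { refl → refl , refl }) (Unique.allFin⁺ h)
    (((λ ()) ∷ []) ∷ [] ∷ [])
  vertices-unique (suc j) = Unique.++⁺ (Unique.map⁺ hub-injective (Unique.allFin⁺ h))
    (Unique.cartesianProductWith⁺ sub (λ { refl → refl , refl }) (Unique.allFin⁺ M) (vertices-unique j))
    disjoint
    where
    disjoint : ∀ {v} → ¬ (v ∈ map hub (allFin h) × v ∈ cartesianProductWith sub (allFin M) (vertices j))
    disjoint (v∈ , v∈') with ∈-map⁻ hub v∈ | ∈-cartesianProductWith⁻ sub (allFin M) (vertices j) v∈'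
    ... | _ , _ , refl | _ , _ , _ , _ , ()

  K size : ℕ
  K    = suc k
  size = length (vertices K)

  vert : Fin size → V K
  vert = lookup (vertices K)

  code : V K → Fin size
  code v = Any.index (∈-vertices v)

  vert-code : ∀ v → vert (code v) ≡ v
  vert-code v = ≡.sym (Any.lookup-index (∈-vertices v))

  code-vert : ∀ i → code (vert i) ≡ i
  code-vert i = lookup-injective (vertices-unique K) (vert-code (vert i))

  code-injective : ∀ {u v} → code u ≡ code v → u ≡ v
  code-injective {u} {v} eq = trans (≡.sym (vert-code u)) (trans (cong vert eq) (vert-code v))

  length-of : Weights size
  length-of i j = Maybe.map ℕ→ℚ (weight (vert i) (vert j))

  length-of⇒Edge : ∀ i j {q} → length-of i j ≡ just q → ∃[ l ] (q ≡ ℕ→ℚ l × Edge (vert i) (vert j) l)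
  length-of⇒Edge i j eq with weight (vert i) (vert j) in weq
  length-of⇒Edge i j refl | just l = l , refl , weight⇒Edge _ _ weq

  Edge⇒length-of : ∀ {u v l} → Edge u v l → length-of (code u) (code v) ≡ just (ℕ→ℚ l)
  Edge⇒length-of {u} {v} e rewrite vert-code u | vert-code v | Edge⇒weight e = refl

  𝒢 : Graph
  𝒢 = record
    { N      = size
    ; len    = length-of
    ; sym    = λ i j → cong (Maybe.map ℕ→ℚ) (weight-sym (vert i) (vert j))
    ; noLoop = λ i → cong (Maybe.map ℕ→ℚ) (weight-irrefl (vert i))
    ; pos    = λ i j q eq → positive (length-of⇒Edge i j eq)
    }
    where
    positive : ∀ {u v q} → ∃[ l ] (q ≡ ℕ→ℚ l × Edge u v l) → 0ℚ ℚ.< q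
    positive (l , refl , e) = ℕ→ℚ-mono-< {0} (ℕ.<-≤-trans (s≤s z≤n) (2≤Edge e))

  Walk⇒Path : ∀ {A i j p d} → Walk length-of A i j p d →
              ∃[ n ] (d ≡ ℕ→ℚ n × Path (vert i) (vert j) (map vert p) n)
  Walk⇒Path (here _) = 0 , refl , here
  Walk⇒Path (step {i} {j} _ e W) with length-of⇒Edge i j e | Walk⇒Path W
  ... | l , refl , e' | n , refl , P = l + n , ≡.sym (ℕ→ℚ-+ l n) , step e' P

  Path⇒Walk : ∀ {u v p n} → Path u v p n → Walk length-of AllV (code u) (code v) (map code p) (ℕ→ℚ n)
  Path⇒Walk here = here _
  Path⇒Walk (step {u} {x} {v} {xs} {l} {n} e P) =
    subst (Walk length-of AllV (code u) (code v) (code u ∷ map code xs)) (≡.sym (ℕ→ℚ-+ l n))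
      (step _ (Edge⇒length-of e) (Path⇒Walk P))

  Path⇒Walk′ : ∀ {i j p n} → Path (vert i) (vert j) p n → Walk length-of AllV i j (map code p) (ℕ→ℚ n)
  Path⇒Walk′ {i} {j} {p} {n} P =
    subst₂ (λ i j → Walk length-of AllV i j (map code p) (ℕ→ℚ n)) (code-vert i) (code-vert j) (Path⇒Walk P)

  module _ (r : ℚ) (0<r : 0ℚ ℚ.< r) where

    private
      Long Near : ℕ → Set
      Long n = r ℚ.≤ ℕ→ℚ n
      Near n = ℕ→ℚ n ℚ.< ℕ→ℚ 4 ℚ.* r

      gap : ∀ m {n} → n ≤ 16 * m → Long n → ¬ Near (4 * (16 * m))
      gap m n≤ long near = <⇒≱ℚ near (begin
        ℕ→ℚ 4 ℚ.* r              ≤⟨ ℚ.*-monoˡ-≤-nonNeg (ℕ→ℚ 4) (ℚ.≤-trans long (ℕ→ℚ-mono-≤ n≤)) ⟩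
        ℕ→ℚ 4 ℚ.* ℕ→ℚ (16 * m)   ≡⟨ ℕ→ℚ-* 4 (16 * m) ⟨
        ℕ→ℚ (4 * (16 * m))       ∎)
        where open ℚ.≤-Reasoning

      open Cover Long Near (λ n → ℕ→ℚ n ℚ.<? _) (λ m≤n → ℚ.≤-<-trans (ℕ→ℚ-mono-≤ m≤n)) gap (<⇒≱ℚ 0<r)

    ball-cover : ∀ v → Σ[ H ∈ List (Fin size) ] (length H ≤ h ×
      (∀ u x p d → Shortest length-of AllV u x p d → r ℚ.≤ d →
         All (λ y → DistLt 𝒢 y v (ℕ→ℚ 4 ℚ.* r)) p → Any (λ y → y ∈ H) p))
    ball-cover v = map code H , ℕ.≤-trans (ℕ.≤-reflexive (List.length-map code H)) (proj₁ (proj₂ (cover (vert v)))) ,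
      λ u x p d (Wk , shortest) r≤d balls → go u x p shortest r≤d balls (Walk⇒Path Wk)
      where
      H : List (V K)
      H = proj₁ (cover (vert v))

      code∈ : ∀ {y} → vert y ∈ H → y ∈ map code H
      code∈ {y} y∈ = subst (_∈ map code H) (code-vert y) (∈-map⁺ code y∈)

      ball : ∀ {y d q} → d ℚ.< ℕ→ℚ 4 ℚ.* r → ∃[ n ] (d ≡ ℕ→ℚ n × Path (vert y) (vert v) q n) → Ball (vert v) (vert y)
      ball lt (m , refl , Q) = _ , m , Q , lt

      go : ∀ u x p {d} → (∀ q e → Walk length-of AllV u x q e → d ℚ.≤ e) → r ℚ.≤ d →
           All (λ y → DistLt 𝒢 y v (ℕ→ℚ 4 ℚ.* r)) p →
           ∃[ n ] (d ≡ ℕ→ℚ n × Path (vert u) (vert x) (map vert p) n) → Any (λ y → y ∈ map code H) p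
      go u x p shortest r≤d balls (n , refl , P) =
        Any.map code∈ (Any.map⁻ (proj₂ (proj₂ (cover (vert v))) _ _ (map vert p) n
          (P , λ q m Q → ℕ→ℚ-cancel-≤ (shortest _ _ (Path⇒Walk′ Q))) r≤d
          (All.map⁺ (All.map (λ (_ , _ , Wy , lt) → ball lt (Walk⇒Path Wy)) balls))))

  hd-upper : HDAtMost 𝒢 h
  hd-upper = ball-cover

  label : ∀ {j} → V j → Fin h
  label (leaf t _) = t
  label (hub t)    = t
  label (sub s v)  = label v

  label-node : ∀ {j} (a : Addr j) t b → label (node a t b) ≡ t
  label-node []      t b = refl
  label-node (s ∷ a) t b = label-node a t b

  Path-slope : ∀ {j} {x c y : V j} (C : NCert x c y) → let open NCert C in
               ∀ {u v p n} → Path u v p n → Φ v ≤ Φ u + n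
  Path-slope C here = ℕ.≤-reflexive (≡.sym (ℕ.+-identityʳ _))
  Path-slope C (step {u} {l = l} {n = n} e P) = ℕ.≤-trans (Path-slope C P) (ℕ.≤-trans (ℕ.+-monoˡ-≤ n slope≤) (ℕ.≤-reflexive (ℕ.+-assoc (Φ u) l n)))
    where
    open NCert C
    slope≤ : Φ _ ≤ Φ u + l
    slope≤ with slope e
    ... | inj₁ lt       = ℕ.<⇒≤ lt
    ... | inj₂ (eq , _) = ℕ.≤-reflexive eq

  NCert-shortest : ∀ {j} {x c y : V j} (C : NCert x c y) → ∀ {p n} → Path x c p n → NCert.l₁ C ≤ n
  NCert-shortest {x = x} C P = ℕ.+-cancelˡ-≤ (Φ x) _ _ (subst (_≤ Φ x + _) rise₁ (Path-slope C P))
    where open NCert C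

  hub-edge≥W : ∀ {j t l} {v : V (suc j)} → Edge (hub t) v l → W (suc j) ≤ l
  hub-edge≥W (down _) = ℕ.m≤m+n _ _

  private
    bottom : Fin h → V K
    bottom t = node (Vec.replicate K s₀) t (par k)

    C[_] : ∀ t → NCert (hub t) (bottom t) (node (Vec.replicate K s₀) t (not (par k)))
    C[ t ] = NCert-partner (Vec.replicate K s₀) zero t t

    module _ (t : Fin h) where
      open NCert C[ t ]

      spoke-length : ℕ
      spoke-length = l₁

      spoke : Shortest length-of AllV (code (hub t)) (code (bottom t)) (code (hub t) ∷ code (bottom t) ∷ []) (ℕ→ℚ (l₁ + 0))
      spoke = Path⇒Walk (step e₁ here) , λ q e Wk → minimal (Walk⇒Path Wk)
        where
        minimal : ∀ {q e} → ∃[ n ] (e ≡ ℕ→ℚ n × Path (vert (code (hub t))) (vert (code (bottom t))) (map vert q) n) → ℕ→ℚ (l₁ + 0) ℚ.≤ e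
        minimal {q} (n , refl , P) = ℕ→ℚ-mono-≤ (subst (_≤ n) (≡.sym (ℕ.+-identityʳ l₁)) (NCert-shortest C[ t ]
          (subst₂ (λ u v → Path u v (map vert q) n) (vert-code (hub t)) (vert-code (bottom t)) P)))

      W≤spoke : W K ≤ l₁
      W≤spoke = hub-edge≥W e₁

    2W+6<4W : (W K + 4) + (W K + 2) < 4 * W K
    2W+6<4W = begin-strict
      (W K + 4) + (W K + 2)  ≡⟨ solve 1 (λ x → (x :+ con 4) :+ (x :+ con 2) := con 2 :* x :+ con 6) refl (W K) ⟩
      2 * W K + 6            <⟨ ℕ.+-monoʳ-< (2 * W K) (ℕ.<-≤-trans (ℕ.m≤m+n 7 121) (ℕ.*-monoʳ-≤ 2 (64≤W k))) ⟩
      2 * W K + 2 * W K      ≡⟨ ℕ.*-distribʳ-+ (W K) 2 2 ⟨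
      4 * W K                ∎
      where
      open ℕ.≤-Reasoning
      open +-*-Solver

    near-hub : ∀ v → DistLt 𝒢 (code v) (code (hub t₀)) (ℕ→ℚ 4 ℚ.* ℕ→ℚ (W K))
    near-hub v = let (_ , n , P , n≤) = to-hub v t₀ in _ , _ , Path⇒Walk P ,
      subst (ℕ→ℚ n ℚ.<_) (ℕ→ℚ-* 4 (W K)) (ℕ→ℚ-mono-< (ℕ.≤-<-trans n≤ 2W+6<4W))

  -- With `r` equal to `W K`, the ball around one top hub is the whole graph. The top edges from
  -- `hub t` to `bottom t`, one for each label, are long shortest paths; `label` takes the value `t`
  -- on both ends, so no vertex covers two of them.
  hd-lower : ¬ HDAtMost 𝒢 (h ∸ 1)
  hd-lower hd = refute (hd (ℕ→ℚ (W K)) (ℕ→ℚ-mono-< {0} (1≤W K)) (code (hub t₀)))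
    where
    h∸1<h : h ∸ 1 < h
    h∸1<h = ℕ.∸-monoʳ-< {o = 0} (s≤s z≤n) (ℕ.≤-trans (s≤s z≤n) (Fin.toℕ<n t₀))

    refute : ¬ (Σ[ H ∈ List (Fin size) ] (length H ≤ h ∸ 1 ×
      (∀ u x p d → Shortest length-of AllV u x p d → ℕ→ℚ (W K) ℚ.≤ d →
         All (λ y → DistLt 𝒢 y (code (hub t₀)) (ℕ→ℚ 4 ℚ.* ℕ→ℚ (W K))) p → Any (λ y → y ∈ H) p)))
    refute (H , len≤ , covers) = ℕ.<⇒≱ (ℕ.≤-<-trans len≤ h∸1<h) (Fin.injective⇒≤ {f = slot} slot-injective)
      where
      labelled : ∀ t → Any (_∈ H) (code (hub t) ∷ code (bottom t) ∷ []) → ∃[ y ] (y ∈ H × label (vert y) ≡ t)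
      labelled t (here y∈)         = _ , y∈ , cong label (vert-code (hub t))
      labelled t (there (here y∈)) = _ , y∈ , trans (cong label (vert-code (bottom t))) (label-node (Vec.replicate K s₀) t (par k))

      hit : ∀ t → ∃[ y ] (y ∈ H × label (vert y) ≡ t)
      hit t = labelled t (covers _ _ _ _ (spoke t) (ℕ→ℚ-mono-≤ (ℕ.≤-trans (W≤spoke t) (ℕ.m≤m+n _ 0)))
        (near-hub _ ∷ near-hub _ ∷ []))

      slot : Fin h → Fin (length H)
      slot t = Any.index (proj₁ (proj₂ (hit t)))

      slot-injective : ∀ {t t'} → slot t ≡ slot t' → t ≡ t'
      slot-injective {t} {t'} eq = trans (≡.sym (proj₂ (proj₂ (hit t)))) (trans
        (cong (label ∘ vert) (trans (Any.lookup-index (proj₁ (proj₂ (hit t)))) (trans (cong (lookup H) eq)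
          (≡.sym (Any.lookup-index (proj₁ (proj₂ (hit t'))))))))
        (proj₂ (proj₂ (hit t'))))

  highway-dimension : HighwayDim 𝒢 h
  highway-dimension = hd-upper , hd-lower

  diameter-between : ∀ C D → 1 ≤ C → D ℚ.≤ ℕ→ℚ (W K) → ℕ→ℚ (16 * W K) ℚ.≤ ℕ→ℚ C ℚ.* D → DiameterBetween 𝒢 C D
  diameter-between C D 1≤C D≤ ≤CD =
    (code (hub t₀) , code (bottom t₀) , λ p d Wk → far (proj₂ (spoke t₀) p d Wk)) , near
    where
    far : ∀ {d} → ℕ→ℚ (spoke-length t₀ + 0) ℚ.≤ d → D ℚ.≤ ℕ→ℚ C ℚ.* d
    far {d} le = begin
      D              ≤⟨ D≤d ⟩
      d              ≡⟨ ℚ.*-identityˡ d ⟨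
      1ℚ ℚ.* d       ≤⟨ ℚ.*-monoʳ-≤-nonNeg d ⦃ ℚ.nonNegative 0≤d ⦄ (ℕ→ℚ-mono-≤ {1} 1≤C) ⟩
      ℕ→ℚ C ℚ.* d    ∎
      where
      open ℚ.≤-Reasoning
      W≤d : ℕ→ℚ (W K) ℚ.≤ d
      W≤d = ℚ.≤-trans (ℕ→ℚ-mono-≤ (ℕ.≤-trans (W≤spoke t₀) (ℕ.m≤m+n _ 0))) le
      D≤d : D ℚ.≤ d
      D≤d = ℚ.≤-trans D≤ W≤d
      0≤d : 0ℚ ℚ.≤ d
      0≤d = ℚ.≤-trans (ℕ→ℚ-mono-≤ {0} {W K} z≤n) W≤d

    near : ∀ u v → DistLe 𝒢 u v (ℕ→ℚ C ℚ.* D)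
    near u v = let (_ , n , P , n≤) = diameter (vert u) (vert v) in _ , _ , Path⇒Walk′ P , ℚ.≤-trans (ℕ→ℚ-mono-≤ n≤) ≤CD

-- Charging shortcuts

-- Recursing by two successors lets `half-parity` strip two adjacent levels at a time, exactly one
-- of which has the given parity.
double : ℕ → ℕ
double zero    = zero
double (suc j) = suc (suc (double j))

length-allFin : ∀ n → length (allFin n) ≡ n
length-allFin n = List.length-tabulate {n = n} id

allFin-suc : ∀ n → allFin (suc n) ≡ zero ∷ map suc (allFin n)
allFin-suc n = cong (zero ∷_) (≡.sym (List.map-tabulate id suc))

one-parity : ∀ p b {n} → when (not p 𝔹.≟ b) 1 + (when (p 𝔹.≟ b) 1 + n) ≡ suc n
one-parity true  true  = refl
one-parity true  false = refl
one-parity false true  = refl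
one-parity false false = refl

half-parity : ∀ b i → count (λ d → par (height d) 𝔹.≟ b) (allFin (double i)) ≡ i
half-parity b zero = refl
half-parity b (suc i) = begin
  count Q? (allFin (suc (suc (double i))))                      ≡⟨ cong (count Q?) (allFin-suc (suc (double i))) ⟩
  count Q? (zero ∷ map suc (allFin (suc (double i))))           ≡⟨ count-∷ Q? zero _ ⟩
  indicator Q? zero + count Q? (map suc (allFin (suc (double i))))
    ≡⟨ cong (indicator Q? zero +_) (trans (count-map Q? suc (allFin (suc (double i)))) (cong (count (Q? ∘ suc)) (allFin-suc (double i)))) ⟩
  indicator Q? zero + count (Q? ∘ suc) (zero ∷ map suc (allFin (double i)))
    ≡⟨ cong (indicator Q? zero +_) (count-∷ (Q? ∘ suc) zero _) ⟩
  indicator Q? zero + (indicator (Q? ∘ suc) zero + count (Q? ∘ suc) (map suc (allFin (double i))))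
    ≡⟨ one-parity (par (double i)) b ⟩
  suc (count (Q? ∘ suc) (map suc (allFin (double i))))          ≡⟨ cong suc (trans (count-map (Q? ∘ suc) suc (allFin (double i))) (half-parity b i)) ⟩
  suc i                                                         ∎
  where
  open ≡.≡-Reasoning
  Q? : Decidable {A = Fin (suc (suc (double i)))} (λ d → par (height d) ≡ b)
  Q? d = par (height d) 𝔹.≟ b

-- The potential over pairs of labels

module Counting (h M : ℕ) (t₀ : Fin h) (s₀ : Fin M) (k J : ℕ)
  (half : ∀ b → count (λ d → par (height d) 𝔹.≟ b) (allFin (suc k)) ≡ J) where

  open Tree h M
  open Network h M t₀ s₀ k
  open DecMembership (Fin._≟_ {size}) using (_∈?_)

  toCert : ∀ {x c y} → NCert x c y → Cert length-of (code x) (code c) (code y)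
  toCert {x} {c} {y} C = record
    { Φ     = Ψ
    ; slope = λ u v q eq → slope′ (length-of⇒Edge u v eq)
    ; l₁    = ℕ→ℚ l₁
    ; l₂    = ℕ→ℚ l₂
    ; e₁    = Edge⇒length-of e₁
    ; e₂    = Edge⇒length-of e₂
    ; rise₁ = rise {x} {c} rise₁
    ; rise₂ = rise {c} {y} rise₂
    ; Φx<Φc = climb {x} {c} e₁ rise₁
    ; Φc<Φy = climb {c} {y} e₂ rise₂
    }
    where
    open NCert C
    Ψ : Fin size → ℚ
    Ψ i = ℕ→ℚ (Φ (vert i))

    Ψ-code : ∀ v → Ψ (code v) ≡ ℕ→ℚ (Φ v)
    Ψ-code v = cong (ℕ→ℚ ∘ Φ) (vert-code v)

    rise : ∀ {u v l} → Φ v ≡ Φ u + l → Ψ (code v) ≡ Ψ (code u) ℚ.+ ℕ→ℚ l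
    rise {u} {v} {l} eq = trans (Ψ-code v) (trans (cong ℕ→ℚ eq)
      (trans (ℕ→ℚ-+ (Φ u) l) (cong (ℚ._+ ℕ→ℚ l) (≡.sym (Ψ-code u)))))

    climb : ∀ {u v l} → Edge u v l → Φ v ≡ Φ u + l → Ψ (code u) ℚ.< Ψ (code v)
    climb {u} {v} e eq = subst₂ ℚ._<_ (≡.sym (Ψ-code u)) (≡.sym (Ψ-code v))
      (ℕ→ℚ-mono-< (subst (Φ u <_) (≡.sym eq) (ℕ.m<m+n (Φ u) (ℕ.<-≤-trans (s≤s z≤n) (2≤Edge e)))))

    code-≡ : ∀ {i v} → vert i ≡ v → i ≡ code v
    code-≡ {i} eq = trans (≡.sym (code-vert i)) (cong code eq)

    slope′ : ∀ {u v q} → ∃[ l ] (q ≡ ℕ→ℚ l × Edge (vert u) (vert v) l) →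
      Ψ v ℚ.< Ψ u ℚ.+ q ⊎ (Ψ v ≡ Ψ u ℚ.+ q × ((u ≡ code x × v ≡ code c) ⊎ (u ≡ code c × v ≡ code y)))
    slope′ {u} {v} (l , refl , e) with slope e
    ... | inj₁ lt = inj₁ (subst (Ψ v ℚ.<_) (ℕ→ℚ-+ (Φ (vert u)) l) (ℕ→ℚ-mono-< lt))
    ... | inj₂ (eq , tight) = inj₂ (trans (cong ℕ→ℚ eq) (ℕ→ℚ-+ (Φ (vert u)) l) , (case tight of λ where
      (inj₁ (p , q)) → inj₁ (code-≡ p , code-≡ q)
      (inj₂ (p , q)) → inj₂ (code-≡ p , code-≡ q)))

  -- Quantifies over the certificates of the original graph, so no triple has to be selected in
  -- advance: whichever three vertices are alive when one of them is contracted, their certificate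
  -- is at hand.
  Inv : Weights size → List (Fin size) → Set
  Inv w R = ∀ {x c y} → NCert x c y → code x ∉ R → code c ∉ R → code y ∉ R →
            Cert w (code x) (code c) (code y) × Cert w (code y) (code c) (code x)

  Inv-start : Inv length-of []
  Inv-start C _ _ _ = toCert C , Cert-reverse (Graph.sym 𝒢) (toCert C)

  Inv-step : ∀ {w R z w' k} → Step w R z w' k → Inv w R → Inv w' (z ∷ R)
  Inv-step S inv C x∉ c∉ y∉ with inv C (x∉ ∘ there) (c∉ ∘ there) (y∉ ∘ there)
  ... | C₁ , C₂ = Cert-Step C₁ S z≢x z≢c z≢y , Cert-Step C₂ S z≢y z≢c z≢x
    where
    z≢x = λ z≡x → x∉ (here (≡.sym z≡x))
    z≢c = λ z≡c → c∉ (here (≡.sym z≡c))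
    z≢y = λ z≡y → y∉ (here (≡.sym z≡y))

  Inv-shortcut : ∀ {w R x c y} → Inv w R → NCert x c y → code x ∉ R → code c ∉ R → code y ∉ R →
    code x ≢ code y × Shortcut w R (code c) (code x) (code y) × Shortcut w R (code c) (code y) (code x)
  Inv-shortcut inv C x∉ c∉ y∉ with inv C x∉ c∉ y∉
  ... | C₁ , C₂ = Cert.x≢y C₁ , Cert⇒Shortcut C₁ x∉ c∉ y∉ , Cert⇒Shortcut C₂ y∉ c∉ x∉

  nodeInfo-hubAt : ∀ {i} (a : Addr i) d t → nodeInfo (hubAt a d t) ≡ nothing
  nodeInfo-hubAt (s ∷ a) zero    t = refl
  nodeInfo-hubAt (s ∷ a) (suc d) t = nodeInfo-hubAt a d t

  hubAt≢node : ∀ {i} (a a' : Addr i) {d t t' b} → hubAt a d t ≢ node a' t' b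
  hubAt≢node a a' {d} {t} {t'} {b} eq
    with trans (≡.sym (nodeInfo-hubAt a d t)) (trans (cong nodeInfo eq) (nodeInfo-node a' t' b))
  ... | ()

  hubAt-injective : ∀ {i} (a a' : Addr i) {d d' t t'} → hubAt a d t ≡ hubAt a' d' t' → d ≡ d' × t ≡ t'
  hubAt-injective (s ∷ a) (s' ∷ a') {zero}  {zero}  refl = refl , refl
  hubAt-injective (s ∷ a) (s' ∷ a') {suc d} {suc d'} eq with hubAt-injective a a' (sub-injectiveʳ eq)
  ... | refl , refl = refl , refl

  node-injective : ∀ {i} (a a' : Addr i) {t t' b b'} → node a t b ≡ node a' t' b' → a ≡ a' × t ≡ t' × b ≡ b'
  node-injective []      []        refl = refl , refl , refl
  node-injective (s ∷ a) (s' ∷ a') eq with sub-injectiveˡ eq | node-injective a a' (sub-injectiveʳ eq)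
  ... | refl | refl , refl , refl = refl , refl , refl

  data View {i} : V i → Set where
    is-node : ∀ a t b → View (node a t b)
    is-hub  : ∀ a d t → View (hubAt a d t)

  view : ∀ {i} (v : V i) → View v
  view (leaf t b)    = is-node [] t b
  -- The coordinates of an address from the hub downwards do not affect the hub; `s₀` fills them.
  view (hub t)       = is-hub (Vec.replicate _ s₀) zero t
  view (sub s v) with view v
  ... | is-node a t b = is-node (s ∷ a) t b
  ... | is-hub a d t  = is-hub (s ∷ a) (suc d) t

  addresses : ∀ i → List (Addr i)
  addresses zero    = [] ∷ []
  addresses (suc i) = cartesianProductWith _∷_ (allFin M) (addresses i)

  addresses-unique : ∀ i → Unique (addresses i)
  addresses-unique zero    = [] ∷ []
  addresses-unique (suc i) =
    Unique.cartesianProductWith⁺ _∷_ Vec.∷-injective (Unique.allFin⁺ M) (addresses-unique i)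

  ∈-addresses : ∀ {i} (a : Addr i) → a ∈ addresses i
  ∈-addresses []      = here refl
  ∈-addresses (s ∷ a) = ∈-cartesianProductWith⁺ _∷_ (∈-allFin s) (∈-addresses a)

  length-addresses : ∀ i → length (addresses i) ≡ M ^ i
  length-addresses zero    = refl
  length-addresses (suc i) = trans (length-cartesianProductWith _∷_ (allFin M) (addresses i))
    (cong₂ _*_ (length-allFin M) (length-addresses i))

  -- The addresses in branch `r` of the cluster at depth `d` above `a`; of `a` only the coordinates
  -- before `d` are kept.
  siblings : ∀ {i} → Addr i → Fin i → Fin M → List (Addr i)
  siblings {suc i} (s ∷ a) zero    r = map (r ∷_) (addresses i)
  siblings (s ∷ a) (suc d) r = map (s ∷_) (siblings a d r)

  length-siblings : ∀ {i} (a : Addr i) d r → length (siblings a d r) ≡ M ^ height d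
  length-siblings {suc i} (s ∷ a) zero    r = trans (List.length-map (r ∷_) (addresses i)) (length-addresses i)
  length-siblings (s ∷ a) (suc d) r = trans (List.length-map (s ∷_) (siblings a d r)) (length-siblings a d r)

  ∈-siblings : ∀ {i} (a a' : Addr i) d t → hubAt a' d t ≡ hubAt a d t → a' ∈ siblings a d (Vec.lookup a' d)
  ∈-siblings (s ∷ a) (s' ∷ a') zero    t _  = ∈-map⁺ (s' ∷_) (∈-addresses a')
  ∈-siblings (s ∷ a) (s' ∷ a') (suc d) t eq with sub-injectiveˡ eq
  ... | refl = ∈-map⁺ (s ∷_) (∈-siblings a a' d t (sub-injectiveʳ eq))

  Fresh : List (Fin size) → Addr K → Fin h → Set
  Fresh R a t = ∀ b → code (node a t b) ∉ R

  fresh? : ∀ R a t → Dec (Fresh R a t)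
  fresh? R a t = map′ (λ { (f , g) true → f ; (f , g) false → g }) (λ f → f true , f false)
    (¬? (code (node a t true) ∈? R) ×-dec ¬? (code (node a t false) ∈? R))

  dead? : ∀ R a t → Decidable {A = Fin K} (λ d → code (hubAt a d t) ∈ R)
  dead? R a t d = code (hubAt a d t) ∈? R

  deadHubs : List (Fin size) → Addr K → Fin h → ℕ
  deadHubs R a t = count (dead? R a t) (allFin K)

  -- The pairs (a , t) and (a , t') together are worth J shortcuts, one for each
  -- hub seen by the first contracted node, minus the hubs that are already gone.
  φ : List (Fin size) → Addr K → Fin h → Fin h → ℕ
  φ R a t t' = when (fresh? R a t) (when (fresh? R a t') (J ∸ (deadHubs R a t + deadHubs R a t')))

  row : List (Fin size) → Addr K → Fin h → ℕ
  row R a t = ∑ (allFin h) (φ R a t)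

  block : List (Fin size) → Addr K → ℕ
  block R a = ∑ (allFin h) (row R a)

  potential : List (Fin size) → ℕ
  potential R = ∑ (addresses K) (block R)

  φ-cases : ∀ R a t t' {n} → (Fresh R a t → Fresh R a t' → J ∸ (deadHubs R a t + deadHubs R a t') ≤ n) → φ R a t t' ≤ n
  φ-cases R a t t' f = when-≤ (fresh? R a t) λ p → when-≤ (fresh? R a t') λ q → f p q

  φ-fresh : ∀ R a t t' → Fresh R a t → Fresh R a t' → φ R a t t' ≡ J ∸ (deadHubs R a t + deadHubs R a t')
  φ-fresh R a t t' p q = trans (when-yes (fresh? R a t) p) (when-yes (fresh? R a t') q)

  φ-compare : ∀ R R' a t t' e → (∀ q → Fresh R a t → Fresh R a t' → q ≡ t ⊎ q ≡ t' → Fresh R' a q) →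
    (Fresh R a t → Fresh R a t' → deadHubs R' a t + deadHubs R' a t' ≤ (deadHubs R a t + deadHubs R a t') + e) →
    φ R a t t' ≤ φ R' a t t' + e
  φ-compare R R' a t t' e keep le = φ-cases R a t t' λ p q → begin
    J ∸ D                     ≤⟨ ℕ.m≤n+m∸n (J ∸ D) e ⟩
    e + (J ∸ D ∸ e)           ≡⟨ ℕ.+-comm e _ ⟩
    J ∸ D ∸ e + e             ≡⟨ cong (_+ e) (ℕ.∸-+-assoc J D e) ⟩
    J ∸ (D + e) + e           ≤⟨ ℕ.+-monoˡ-≤ e (ℕ.∸-monoʳ-≤ J (le p q)) ⟩
    J ∸ (deadHubs R' a t + deadHubs R' a t') + e
      ≡⟨ cong (_+ e) (φ-fresh R' a t t' (keep t p q (inj₁ refl)) (keep t' p q (inj₂ refl))) ⟨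
    φ R' a t t' + e           ∎
    where
    open ℕ.≤-Reasoning
    D = deadHubs R a t + deadHubs R a t'

  potential-[] : potential [] ≡ M ^ K * (h * (h * J))
  potential-[] = begin
    ∑ (addresses K) (block [])               ≡⟨ ∑-cong (addresses K) block-[] ⟩
    ∑ (addresses K) (λ _ → h * (h * J))      ≡⟨ ∑-const (addresses K) _ ⟩
    length (addresses K) * (h * (h * J))     ≡⟨ cong (_* (h * (h * J))) (length-addresses K) ⟩
    M ^ K * (h * (h * J))                    ∎
    where
    open ≡.≡-Reasoning
    ∑-cong : ∀ {A : Set} (xs : List A) {f g} → (∀ x → f x ≡ g x) → ∑ xs f ≡ ∑ xs g
    ∑-cong xs eq = cong sum (List.map-cong eq xs)
    ∑h : ∀ c → ∑ (allFin h) (λ _ → c) ≡ h * c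
    ∑h c = trans (∑-const (allFin h) c) (cong (_* c) (length-allFin h))
    none : ∀ a t → deadHubs [] a t ≡ 0
    none a t = ℕ.n≤0⇒n≡0 (Unique-⊆-length {ys = []} (Unique.filter⁺ (dead? [] a t) (Unique.allFin⁺ K))
      λ d∈ → case proj₂ (∈-filter⁻ (dead? [] a t) {xs = allFin K} d∈) of λ ())
    φ-[] : ∀ a t t' → φ [] a t t' ≡ J
    φ-[] a t t' = trans (φ-fresh [] a t t' (λ _ ()) (λ _ ())) (cong (J ∸_) (cong₂ _+_ (none a t) (none a t')))
    row-[] : ∀ a t → row [] a t ≡ h * J
    row-[] a t = trans (∑-cong (allFin h) (φ-[] a t)) (∑h J)
    block-[] : ∀ a → block [] a ≡ h * (h * J)
    block-[] a = trans (∑-cong (allFin h) (row-[] a)) (∑h (h * J))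

  potential-end : ∀ R → (∀ i → i ∈ R) → potential R ≡ 0
  potential-end R all = ℕ.n≤0⇒n≡0 (zeros (addresses K) λ a → zeros (allFin h) λ t → zeros (allFin h) λ t' →
    φ-cases R a t t' λ p _ → contradiction (all _) (p true))
    where
    zeros : ∀ {A : Set} (xs : List A) {f} → (∀ x → f x ≤ 0) → ∑ xs f ≤ 0
    zeros xs f≤0 = ℕ.≤-trans (∑-mono xs f≤0) (ℕ.≤-reflexive (trans (∑-const xs 0) (ℕ.*-zeroʳ (length xs))))

-- Loss of potential in one contraction

module Charging (h M : ℕ) (t₀ : Fin h) (s₀ : Fin M) (k J : ℕ)
  (half : ∀ b → count (λ d → par (height d) 𝔹.≟ b) (allFin (suc k)) ≡ J) where

  open Tree h M
  open Network h M t₀ s₀ k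
  open Counting h M t₀ s₀ k J half
  open DecMembership (Fin._≟_ {size}) using (_∈?_)

  _≟ₐ_ : ∀ {i} (a a' : Addr i) → Dec (a ≡ a')
  _≟ₐ_ = Vec.≡-dec Fin._≟_

  module NodeStep {w w' R k'} (a₀ : Addr K) (q : Fin h) (b : Bool)
    (S : Step w R (code (node a₀ q b)) w' k') (inv : Inv w R) (v∉R : code (node a₀ q b) ∉ R) where

    private
      R' : List (Fin size)
      R' = code (node a₀ q b) ∷ R

    deadHubs-node : ∀ a t → deadHubs R' a t ≤ deadHubs R a t
    deadHubs-node a t = count-mono (dead? R' a t) (dead? R a t) (allFin K) λ where
      d (here eq)  → contradiction (code-injective eq) (hubAt≢node a a₀)
      d (there d∈) → d∈

    fresh-kept : ∀ a t → ¬ (a ≡ a₀ × t ≡ q) → Fresh R a t → Fresh R' a t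
    fresh-kept a t ne fresh c (here eq)  with node-injective a a₀ (code-injective eq)
    ... | a≡ , t≡ , _ = ne (a≡ , t≡)
    fresh-kept a t ne fresh c (there v∈) = fresh c v∈

    φ-kept : ∀ a t t' → (Fresh R a t → Fresh R a t' → ¬ (a ≡ a₀ × t ≡ q) × ¬ (a ≡ a₀ × t' ≡ q)) →
             φ R a t t' ≤ φ R' a t t'
    φ-kept a t t' ne = ℕ.≤-trans (φ-compare R R' a t t' 0
        (λ { _ p p' (inj₁ refl) → fresh-kept a t (proj₁ (ne p p')) p
           ; _ p p' (inj₂ refl) → fresh-kept a t' (proj₂ (ne p p')) p' })
        (λ _ _ → ℕ.≤-trans (ℕ.+-mono-≤ (deadHubs-node a t) (deadHubs-node a t')) (ℕ.m≤m+n _ 0)))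
      (ℕ.≤-reflexive (ℕ.+-identityʳ _))

    seen : Fin h → ℕ
    seen t = J ∸ deadHubs R a₀ t

    E : ℕ
    E = ∑ (allFin h) seen

    φ≤seenʳ : ∀ t t' → φ R a₀ t t' ≤ seen t'
    φ≤seenʳ t t' = φ-cases R a₀ t t' λ _ _ → ℕ.∸-monoʳ-≤ J (ℕ.m≤n+m _ (deadHubs R a₀ t))

    φ≤seenˡ : ∀ t t' → φ R a₀ t t' ≤ seen t
    φ≤seenˡ t t' = φ-cases R a₀ t t' λ _ _ → ℕ.∸-monoʳ-≤ J (ℕ.m≤m+n (deadHubs R a₀ t) _)

    row-other : ∀ t → t ≢ q → row R a₀ t ≤ row R' a₀ t + seen t
    row-other t t≢q = ∑-≤-except q (Unique.allFin⁺ h)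
      (λ t' t'≢q → φ-kept a₀ t t' λ _ _ → t≢q ∘ proj₂ , t'≢q ∘ proj₂)
      (ℕ.≤-trans (φ≤seenˡ t q) (ℕ.m≤n+m _ _)) (Fin._≟ q)

    -- View `φ` at `a₀` as a matrix over labels. Only row `q` and column `q` vanish, and subtracting
    -- the dead hubs of both labels bounds an entry by the `seen` value of either one. The row and
    -- the column therefore lose at most `E` each.
    block-touched : block R a₀ ≤ block R' a₀ + (E + E)
    block-touched = begin
      block R a₀                                              ≤⟨ ∑-≤-except {c = E} q (Unique.allFin⁺ h) row-other
                                                                   (ℕ.≤-trans (∑-mono (allFin h) (φ≤seenʳ q)) (ℕ.m≤n+m E _)) (Fin._≟ q) ⟩
      ∑ (allFin h) (λ t → row R' a₀ t + seen t) + E           ≡⟨ cong (_+ E) (∑-+ (allFin h) (row R' a₀) seen) ⟩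
      block R' a₀ + E + E                                     ≡⟨ ℕ.+-assoc (block R' a₀) E E ⟩
      block R' a₀ + (E + E)                                   ∎
      where open ℕ.≤-Reasoning

    potential-touched : potential R ≤ potential R' + (E + E)
    potential-touched = ∑-≤-except a₀ (addresses-unique K)
      (λ a a≢ → ∑-mono (allFin h) λ t → ∑-mono (allFin h) λ t' → φ-kept a t t' λ _ _ → a≢ ∘ proj₁ , a≢ ∘ proj₁)
      block-touched (_≟ₐ a₀)

    -- The second node of a pair costs nothing: its entries were already lost with the first.
    potential-stale : ¬ Fresh R a₀ q → potential R ≤ potential R'
    potential-stale stale = ∑-mono (addresses K) λ a → ∑-mono (allFin h) λ t → ∑-mono (allFin h) λ t' →
      φ-kept a t t' λ p p' → (λ { (refl , refl) → stale p }) , (λ { (refl , refl) → stale p' })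

    module _ (fresh : Fresh R a₀ q) where

      Seen : Fin h × Fin K → Set
      Seen (t , d) = par (height d) ≡ b × code (hubAt a₀ d t) ∉ R

      Seen? : Decidable Seen
      Seen? (t , d) = (par (height d) 𝔹.≟ b) ×-dec ¬? (code (hubAt a₀ d t) ∈? R)

      seenPairs : List (Fin h × Fin K)
      seenPairs = filter Seen? (cartesianProduct (allFin h) (allFin K))

      ends : Fin h × Fin K → Fin size × Fin size
      ends (t , d) = code (hubAt a₀ d t) , code (node a₀ q (not b))

      -- Of the `J` hubs of parity `b`, those that are not seen are dead. `deadHubs` also counts
      -- dead hubs of the other parity, which only lowers `seen`.
      seen≤ : ∀ t → seen t ≤ count (λ d → Seen? (t , d)) (allFin K)
      seen≤ t = ℕ.m≤n+o⇒m∸n≤o J (deadHubs R a₀ t) (begin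
        J                                                        ≡⟨ half b ⟨
        count (λ d → par (height d) 𝔹.≟ b) (allFin K)            ≤⟨ count-⊎ (λ d → par (height d) 𝔹.≟ b) (dead? R a₀ t) (λ d → Seen? (t , d)) (allFin K) split ⟩
        deadHubs R a₀ t + count (λ d → Seen? (t , d)) (allFin K) ∎)
        where
        open ℕ.≤-Reasoning
        split : ∀ d → par (height d) ≡ b → code (hubAt a₀ d t) ∈ R ⊎ Seen (t , d)
        split d eq with code (hubAt a₀ d t) ∈? R
        ... | yes d∈ = inj₁ d∈
        ... | no d∉  = inj₂ (eq , d∉)

      ends-shortcut : ∀ {u x} → (u , x) ∈ map ends seenPairs →
        u ≢ x × Shortcut w R (code (node a₀ q b)) u x × Shortcut w R (code (node a₀ q b)) x u
      ends-shortcut ux∈ with ∈-map⁻ ends ux∈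
      ... | (t , d) , td∈ , refl with ∈-filter⁻ Seen? {xs = cartesianProduct (allFin h) (allFin K)} td∈
      ...   | _ , refl , d∉ = Inv-shortcut inv (NCert-partner a₀ d q t) d∉ v∉R (fresh (not b))

      E≤2k : E ≤ 2 * k'
      E≤2k = begin
        E                                                        ≤⟨ ∑-mono (allFin h) seen≤ ⟩
        ∑ (allFin h) (λ t → count (λ d → Seen? (t , d)) (allFin K)) ≡⟨ count-cartesianProduct Seen? (allFin h) (allFin K) ⟨
        length seenPairs                                         ≡⟨ List.length-map ends seenPairs ⟨
        length (map ends seenPairs)                              ≤⟨ count-shortcuts S _ ends-unique ends-shortcut ⟩
        2 * k'                                                   ∎
        where
        open ℕ.≤-Reasoning
        ends-injective : ∀ {x y} → ends x ≡ ends y → x ≡ y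
        ends-injective eq with hubAt-injective a₀ a₀ (code-injective (Product.,-injectiveˡ eq))
        ... | refl , refl = refl
        ends-unique : Unique (map ends seenPairs)
        ends-unique = Unique.map⁺ ends-injective (Unique.filter⁺ Seen?
          (Unique.cartesianProduct⁺ (Unique.allFin⁺ h) (Unique.allFin⁺ K)))

    potential-node : potential R ≤ potential R' + 4 * k'
    potential-node with fresh? R a₀ q
    ... | no stale  = ℕ.≤-trans (potential-stale stale) (ℕ.m≤m+n _ _)
    ... | yes fresh = ℕ.≤-trans potential-touched (ℕ.+-monoʳ-≤ (potential R')
      (ℕ.≤-trans (ℕ.+-mono-≤ (E≤2k fresh) (E≤2k fresh)) (ℕ.≤-reflexive (≡.sym (ℕ.*-distribʳ-+ k' 2 2)))))

  module HubStep {w w' R k'} (a₀ : Addr K) (d₀ : Fin K) (q : Fin h)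
    (S : Step w R (code (hubAt a₀ d₀ q)) w' k') (inv : Inv w R) (v∉R : code (hubAt a₀ d₀ q) ∉ R) where

    private
      R' : List (Fin size)
      R' = code (hubAt a₀ d₀ q) ∷ R

    -- Only at these addresses can the death of this hub lower `φ`, and their living nodes of label
    -- `q` are the endpoints of the shortcuts that pay for it.
    Client : Addr K → Set
    Client a = hubAt a d₀ q ≡ hubAt a₀ d₀ q × Fresh R a q

    client? : Decidable Client
    client? a = (hubAt a d₀ q ≟ᵥ hubAt a₀ d₀ q) ×-dec fresh? R a q

    clients : List (Addr K)
    clients = filter client? (addresses K)

    m A : ℕ
    m = M ^ height d₀
    A = length clients

    loss : Addr K → Fin h → ℕ
    loss a t = when (t Fin.≟ q) (indicator client? a)

    loss-q : ∀ a → Client a → loss a q ≡ 1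
    loss-q a c = trans (when-yes (q Fin.≟ q) refl) (indicator-yes client? c)

    -- The contracted hub counts for `(a , t)` only if `t` is `q` and it lies above `a`, and then at
    -- the single depth `d₀`.
    deadHubs-hub : ∀ a t → Fresh R a t → deadHubs R' a t ≤ deadHubs R a t + loss a t
    deadHubs-hub a t fresh = ℕ.≤-trans
      (count-⊎ (dead? R' a t) (dead? R a t) (λ d → hubAt a d t ≟ᵥ hubAt a₀ d₀ q) (allFin K) (λ where
        d (here eq)  → inj₂ (code-injective eq)
        d (there d∈) → inj₁ d∈))
      (ℕ.+-monoʳ-≤ (deadHubs R a t) killed)
      where
      is-v? : Decidable {A = Fin K} (λ d → hubAt a d t ≡ hubAt a₀ d₀ q)
      is-v? d = hubAt a d t ≟ᵥ hubAt a₀ d₀ q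

      killed : count is-v? (allFin K) ≤ loss a t
      killed with filter is-v? (allFin K) in eq
      ... | [] = z≤n
      ... | d ∷ ds with proj₂ (∈-filter⁻ is-v? {xs = allFin K} (subst (d ∈_) (≡.sym eq) (here refl)))
      ...   | d-v with hubAt-injective a a₀ d-v
      ...     | refl , refl = subst (suc (length ds) ≤_) (≡.sym (loss-q a (d-v , fresh)))
        (Unique-⊆-length {ys = d₀ ∷ []} (subst Unique eq (Unique.filter⁺ is-v? (Unique.allFin⁺ K))) λ {d'} d'∈ →
          here (proj₁ (hubAt-injective a a₀ (proj₂ (∈-filter⁻ is-v? {xs = allFin K} (subst (d' ∈_) (≡.sym eq) d'∈))))))

    φ-hub : ∀ a t t' → φ R a t t' ≤ φ R' a t t' + (loss a t + loss a t')
    φ-hub a t t' = φ-compare R R' a t t' (loss a t + loss a t')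
      (λ { _ p p' (inj₁ refl) → kept p ; _ p p' (inj₂ refl) → kept p' })
      λ p p' → ℕ.≤-trans (ℕ.+-mono-≤ (deadHubs-hub a t p) (deadHubs-hub a t' p'))
        (ℕ.≤-reflexive (solve 4 (λ x y z u → (x :+ y) :+ (z :+ u) := (x :+ z) :+ (y :+ u)) refl
          (deadHubs R a t) (loss a t) (deadHubs R a t') (loss a t')))
      where
      open +-*-Solver
      kept : ∀ {t} → Fresh R a t → Fresh R' a t
      kept fresh c (here eq)  = hubAt≢node a₀ a (≡.sym (code-injective eq))
      kept fresh c (there v∈) = fresh c v∈

    ∑-loss : ∀ a → ∑ (allFin h) (loss a) ≤ indicator client? a
    ∑-loss a = ℕ.≤-trans (∑-≤-except {g = λ _ → 0} {c = indicator client? a} q (Unique.allFin⁺ h)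
        (λ t t≢q → when-≤ (t Fin.≟ q) (λ t≡q → contradiction t≡q t≢q))
        (when-≤ (q Fin.≟ q) (λ _ → ℕ.≤-refl)) (Fin._≟ q))
      (ℕ.≤-reflexive (cong (_+ indicator client? a) (trans (∑-const (allFin h) 0) (ℕ.*-zeroʳ (length (allFin h))))))

    -- The loss is confined to row `q` and column `q` of the label matrix, with `h` entries each;
    -- the diagonal entry may lose twice.
    block-hub : ∀ a → block R a ≤ block R' a + 2 * h * indicator client? a
    block-hub a = begin
      block R a                                                    ≤⟨ ∑-mono (allFin h) row-hub ⟩
      ∑ (allFin h) (λ t → row R' a t + (h * loss a t + c))         ≡⟨ ∑-+ (allFin h) (row R' a) _ ⟩
      block R' a + ∑ (allFin h) (λ t → h * loss a t + c)           ≡⟨ cong (block R' a +_) (∑-+ (allFin h) _ _) ⟩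
      block R' a + (∑ (allFin h) (λ t → h * loss a t) + ∑ (allFin h) (λ _ → c))
        ≡⟨ cong (block R' a +_) (cong₂ _+_ (∑-* (allFin h) h (loss a)) (∑h c)) ⟩
      block R' a + (h * ∑ (allFin h) (loss a) + h * c)
        ≤⟨ ℕ.+-monoʳ-≤ (block R' a) (ℕ.+-monoˡ-≤ (h * c) (ℕ.*-monoʳ-≤ h (∑-loss a))) ⟩
      block R' a + (h * c + h * c)
        ≡⟨ cong (block R' a +_) (solve 2 (λ h c → h :* c :+ h :* c := con 2 :* h :* c) refl h c) ⟩
      block R' a + 2 * h * c                                       ∎
      where
      open ℕ.≤-Reasoning
      open +-*-Solver
      c = indicator client? a
      ∑h : ∀ x → ∑ (allFin h) (λ _ → x) ≡ h * x
      ∑h x = trans (∑-const (allFin h) x) (cong (_* x) (length-allFin h))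
      row-hub : ∀ t → row R a t ≤ row R' a t + (h * loss a t + c)
      row-hub t = begin
        row R a t                                                    ≤⟨ ∑-mono (allFin h) (φ-hub a t) ⟩
        ∑ (allFin h) (λ t' → φ R' a t t' + (loss a t + loss a t'))   ≡⟨ ∑-+ (allFin h) (φ R' a t) _ ⟩
        row R' a t + ∑ (allFin h) (λ t' → loss a t + loss a t')      ≡⟨ cong (row R' a t +_) (∑-+ (allFin h) _ _) ⟩
        row R' a t + (∑ (allFin h) (λ _ → loss a t) + ∑ (allFin h) (loss a))
          ≤⟨ ℕ.+-monoʳ-≤ (row R' a t) (ℕ.+-mono-≤ (ℕ.≤-reflexive (∑h (loss a t))) (∑-loss a)) ⟩
        row R' a t + (h * loss a t + c)                              ∎

    potential-lost : potential R ≤ potential R' + 2 * h * A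
    potential-lost = begin
      potential R                                                          ≤⟨ ∑-mono (addresses K) block-hub ⟩
      ∑ (addresses K) (λ a → block R' a + 2 * h * indicator client? a)     ≡⟨ ∑-+ (addresses K) (block R') _ ⟩
      potential R' + ∑ (addresses K) (λ a → 2 * h * indicator client? a)
        ≡⟨ cong (potential R' +_) (trans (∑-* (addresses K) (2 * h) _) (cong (2 * h *_) (∑-indicator client? (addresses K)))) ⟩
      potential R' + 2 * h * A                                             ∎
      where open ℕ.≤-Reasoning

    Apart : Addr K × Addr K → Set
    Apart (a , a') = Vec.lookup a d₀ ≢ Vec.lookup a' d₀

    apart? : Decidable Apart
    apart? (a , a') = ¬? (Vec.lookup a d₀ Fin.≟ Vec.lookup a' d₀)

    apartPairs : List (Addr K × Addr K)
    apartPairs = filter apart? (cartesianProduct clients clients)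

    clients-unique : Unique clients
    clients-unique = Unique.filter⁺ client? (addresses-unique K)

    A∸m≤ : ∀ a → A ∸ m ≤ count (λ a' → apart? (a , a')) clients
    A∸m≤ a = ℕ.m≤n+o⇒m∸n≤o A m (begin
      A                                              ≡⟨ cong length (List.filter-all (λ _ → yes _) (All.universal (λ _ → _) clients)) ⟨
      count {P = λ _ → ⊤} (λ _ → yes _) clients      ≤⟨ count-⊎ (λ _ → yes _) together? (λ a' → apart? (a , a')) clients split ⟩
      count together? clients + count (λ a' → apart? (a , a')) clients
        ≤⟨ ℕ.+-monoˡ-≤ _ (ℕ.≤-trans (Unique-⊆-length (Unique.filter⁺ together? clients-unique) near)
             (ℕ.≤-reflexive (length-siblings a₀ d₀ (Vec.lookup a d₀)))) ⟩
      m + count (λ a' → apart? (a , a')) clients     ∎)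
      where
      open ℕ.≤-Reasoning
      together? : Decidable (λ a' → Vec.lookup a d₀ ≡ Vec.lookup a' d₀)
      together? a' = Vec.lookup a d₀ Fin.≟ Vec.lookup a' d₀
      split : ∀ a' → ⊤ → Vec.lookup a d₀ ≡ Vec.lookup a' d₀ ⊎ Apart (a , a')
      split a' _ with together? a'
      ... | yes eq = inj₁ eq
      ... | no ne  = inj₂ ne
      near : ∀ {a'} → a' ∈ filter together? clients → a' ∈ siblings a₀ d₀ (Vec.lookup a d₀)
      near {a'} a'∈ with ∈-filter⁻ together? {xs = clients} a'∈
      ... | a'∈clients , eq = subst (λ s → a' ∈ siblings a₀ d₀ s) (≡.sym eq)
        (∈-siblings a₀ a' d₀ q (proj₁ (proj₂ (∈-filter⁻ client? {xs = addresses K} a'∈clients))))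

    b₀ : Bool
    b₀ = par (height d₀)

    ends : Addr K × Addr K → Fin size × Fin size
    ends (a , a') = code (node a q b₀) , code (node a' q b₀)

    ends-shortcut : ∀ {u x} → (u , x) ∈ map ends apartPairs →
      u ≢ x × Shortcut w R (code (hubAt a₀ d₀ q)) u x × Shortcut w R (code (hubAt a₀ d₀ q)) x u
    ends-shortcut ux∈ with ∈-map⁻ ends ux∈
    ... | (a , a') , aa'∈ , refl with ∈-filter⁻ apart? {xs = cartesianProduct clients clients} aa'∈
    ...   | aa'∈cc , apart with ∈-cartesianProduct⁻ clients clients aa'∈cc
    ...     | a∈ , a'∈ with proj₂ (∈-filter⁻ client? {xs = addresses K} a∈) | proj₂ (∈-filter⁻ client? {xs = addresses K} a'∈)
    ...       | a-v , fresh | a'-v , fresh' =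
      Inv-shortcut inv (subst (λ v → NCert (node a q b₀) v (node a' q b₀)) a-v
          (NCert-hub a a' d₀ q (trans a-v (≡.sym a'-v)) apart))
        (fresh b₀) v∉R (fresh' b₀)

    -- Every client is apart from all clients outside its own branch, and a branch holds at most `m`
    -- of them. The ordered pairs account for the factor 2.
    quadratic : A * (A ∸ m) ≤ 2 * k'
    quadratic = begin
      A * (A ∸ m)                                                        ≡⟨ ∑-const clients (A ∸ m) ⟨
      ∑ clients (λ _ → A ∸ m)                                            ≤⟨ ∑-mono clients A∸m≤ ⟩
      ∑ clients (λ a → count (λ a' → apart? (a , a')) clients)           ≡⟨ count-cartesianProduct apart? clients clients ⟨
      length apartPairs                                                  ≡⟨ List.length-map ends apartPairs ⟨
      length (map ends apartPairs)                                       ≤⟨ count-shortcuts S _ ends-unique ends-shortcut ⟩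
      2 * k'                                                             ∎
      where
      open ℕ.≤-Reasoning
      ends-injective : ∀ {x y} → ends x ≡ ends y → x ≡ y
      ends-injective {a , a'} {c , c'} eq
        with node-injective a c (code-injective (Product.,-injectiveˡ eq)) | node-injective a' c' (code-injective (Product.,-injectiveʳ eq))
      ... | refl , _ | refl , _ = refl
      ends-unique : Unique (map ends apartPairs)
      ends-unique = Unique.map⁺ ends-injective (Unique.filter⁺ apart? (Unique.cartesianProduct⁺ clients-unique clients-unique))

    -- At most m clients share a branch; the term m + h pays for the hubs
    -- contracted when they have too few clients to create A * h shortcuts.
    potential-hub : potential R ≤ potential R' + (4 * k' + 2 * h * (m + h))
    potential-hub = ℕ.≤-trans potential-lost (ℕ.+-monoʳ-≤ (potential R') charge)
      where
      open ℕ.≤-Reasoning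
      open +-*-Solver
      charge : 2 * h * A ≤ 4 * k' + 2 * h * (m + h)
      charge with A ℕ.≤? m + h
      ... | yes A≤ = ℕ.≤-trans (ℕ.*-monoʳ-≤ (2 * h) A≤) (ℕ.m≤n+m _ (4 * k'))
      ... | no A≰  = begin
        2 * h * A                   ≡⟨ solve 2 (λ h A → con 2 :* h :* A := con 2 :* (A :* h)) refl h A ⟩
        2 * (A * h)                 ≤⟨ ℕ.*-monoʳ-≤ 2 (ℕ.*-monoʳ-≤ A (ℕ.m+n≤o⇒m≤o∸n h (subst (_≤ A) (ℕ.+-comm m h) (ℕ.<⇒≤ (ℕ.≰⇒> A≰))))) ⟩
        2 * (A * (A ∸ m))           ≤⟨ ℕ.*-monoʳ-≤ 2 quadratic ⟩
        2 * (2 * k')                ≡⟨ ℕ.*-assoc 2 2 k' ⟨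
        4 * k'                      ≤⟨ ℕ.m≤m+n (4 * k') _ ⟩
        4 * k' + 2 * h * (m + h)    ∎

-- Summing over a whole contraction ordering

module Bound (h M : ℕ) (t₀ : Fin h) (s₀ : Fin M) (j : ℕ) (8+8h≤M : 8 * suc h ≤ M) where

  private
    J k : ℕ
    J = suc j
    k = suc (double j)

  open Tree h M
  open Network h M t₀ s₀ k
  open Counting h M t₀ s₀ k J (λ b → half-parity b J)
  open Charging h M t₀ s₀ k J (λ b → half-parity b J)

  -- The loss that shortcuts need not pay for. It depends on the vertex alone and not on the moment
  -- of its contraction, so its total is the same for all orderings.
  slack : ∀ {i} → V i → ℕ
  slack (leaf _ _)  = 0
  slack (hub {i} _) = 2 * h * (M ^ i + h)
  slack (sub _ v)   = slack v

  slack-hubAt : ∀ {i} (a : Addr i) d t → slack (hubAt a d t) ≡ 2 * h * (M ^ height d + h)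
  slack-hubAt (s ∷ a) zero    t = refl
  slack-hubAt (s ∷ a) (suc d) t = slack-hubAt a d t

  step-bound : ∀ {w R w' n} u → Step w R (code u) w' n → Inv w R → code u ∉ R →
               potential R ≤ potential (code u ∷ R) + (4 * n + slack u)
  step-bound {R = R} {n = n} u S inv u∉ with view u
  ... | is-node a t b = ℕ.≤-trans (NodeStep.potential-node a t b S inv u∉)
                          (ℕ.+-monoʳ-≤ (potential (code (node a t b) ∷ R)) (ℕ.m≤m+n (4 * n) _))
  ... | is-hub a d t  = subst (λ x → potential R ≤ potential (code (hubAt a d t) ∷ R) + (4 * n + x))
                          (≡.sym (slack-hubAt a d t)) (HubStep.potential-hub a d t S inv u∉)

  -- The losses telescope, and the potential ends at 0 because every vertex has been contracted.
  run-bound : ∀ {w R vs n} → Run w R vs n → Inv w R → All (_∉ R) vs → Unique vs →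
              (∀ i → i ∈ R ⊎ i ∈ vs) → potential R ≤ 4 * n + ∑ vs (slack ∘ vert)
  run-bound {R = R} done _ _ _ all = ℕ.≤-reflexive (potential-end R λ i → [ id , (λ ()) ]′ (all i))
  run-bound {R = R} (next {v = v} {vs = vs} {w' = w'} {k = n} {m = n'} S run) inv (v∉ ∷ vs∉) (v≢ ∷ unique) all = begin
    potential R
      ≤⟨ subst (λ i → potential R ≤ potential (i ∷ R) + (4 * n + slack (vert v))) (code-vert v)
           (step-bound (vert v) (subst (λ i → Step _ R i w' n) (≡.sym (code-vert v)) S) inv (subst (_∉ R) (≡.sym (code-vert v)) v∉)) ⟩
    potential (v ∷ R) + (4 * n + slack (vert v))
      ≤⟨ ℕ.+-monoˡ-≤ _ (run-bound run (Inv-step S inv) (All.zipWith still-alive (v≢ , vs∉)) unique covered) ⟩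
    4 * n' + ∑ vs (slack ∘ vert) + (4 * n + slack (vert v))
      ≡⟨ solve 4 (λ n n' x y → con 4 :* n' :+ x :+ (con 4 :* n :+ y) := con 4 :* (n :+ n') :+ (y :+ x)) refl
           n n' (∑ vs (slack ∘ vert)) (slack (vert v)) ⟩
    4 * (n + n') + ∑ (v ∷ vs) (slack ∘ vert)  ∎
    where
    open ℕ.≤-Reasoning
    open +-*-Solver
    still-alive : ∀ {i} → v ≢ i × i ∉ R → i ∉ v ∷ R
    still-alive (v≢i , _)   (here i≡v) = v≢i (≡.sym i≡v)
    still-alive (_   , i∉R) (there i∈) = i∉R i∈
    covered : ∀ i → i ∈ v ∷ R ⊎ i ∈ vs
    covered i with all i
    ... | inj₁ i∈R         = inj₁ (there i∈R)
    ... | inj₂ (here i≡v)  = inj₁ (here i≡v)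
    ... | inj₂ (there i∈)  = inj₂ i∈

  totalSlack : ℕ → ℕ
  totalSlack i = ∑ (vertices i) slack

  totalSlack-suc : ∀ i → totalSlack (suc i) ≡ h * (2 * h * (M ^ i + h)) + M * totalSlack i
  totalSlack-suc i = begin
    ∑ (map hub (allFin h) ++ cartesianProductWith sub (allFin M) (vertices i)) slack
      ≡⟨ trans (cong sum (List.map-++ slack (map hub (allFin h)) _)) (sum-++ (map slack (map hub (allFin h))) _) ⟩
    ∑ (map hub (allFin h)) slack + ∑ (cartesianProductWith sub (allFin M) (vertices i)) slack
      ≡⟨ cong₂ _+_ (trans (∑-map hub slack (allFin h)) (∑-const (allFin h) _))
           (trans (∑-cartesianProductWith sub slack (allFin M) (vertices i)) (∑-const (allFin M) _)) ⟩
    length (allFin h) * (2 * h * (M ^ i + h)) + length (allFin M) * totalSlack i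
      ≡⟨ cong₂ (λ x y → x * (2 * h * (M ^ i + h)) + y * totalSlack i) (length-allFin h) (length-allFin M) ⟩
    h * (2 * h * (M ^ i + h)) + M * totalSlack i  ∎
    where open ≡.≡-Reasoning

  1≤M^ : ∀ i → 1 ≤ M ^ i
  1≤M^ i = ℕ.m^n>0 M ⦃ ℕ.>-nonZero (ℕ.≤-trans (s≤s z≤n) 8+8h≤M) ⦄ i

  -- The factor `M` on the left is the gain. The slack of a hub grows like one branch, `M ^ i`,
  -- while its cluster has `M ^ suc i` addresses, so each level contributes only a fraction of order
  -- `1 / M` of the number of addresses.
  totalSlack-bound : ∀ i → M * totalSlack i ≤ suc h * (2 * (h * h) * i * M ^ i)
  totalSlack-bound zero = ℕ.≤-trans (ℕ.≤-reflexive (trans (cong (M *_) no-slack) (ℕ.*-zeroʳ M))) z≤n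
    where
    no-slack : totalSlack 0 ≡ 0
    no-slack = trans (∑-cartesianProductWith leaf slack (allFin h) (true ∷ false ∷ []))
      (trans (∑-const (allFin h) 0) (ℕ.*-zeroʳ (length (allFin h))))
  totalSlack-bound (suc i) = begin
    M * totalSlack (suc i)                                            ≡⟨ cong (M *_) (totalSlack-suc i) ⟩
    M * (h * (2 * h * (P + h)) + M * totalSlack i)
      ≤⟨ ℕ.*-monoʳ-≤ M (ℕ.+-mono-≤ (ℕ.*-monoʳ-≤ h (ℕ.*-monoʳ-≤ (2 * h) P+h≤)) (totalSlack-bound i)) ⟩
    M * (h * (2 * h * (suc h * P)) + suc h * (2 * (h * h) * i * P))
      ≡⟨ solve 4 (λ M h i P → M :* (h :* (con 2 :* h :* ((con 1 :+ h) :* P)) :+ (con 1 :+ h) :* (con 2 :* (h :* h) :* i :* P))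
           := (con 1 :+ h) :* (con 2 :* (h :* h) :* (con 1 :+ i) :* (M :* P))) refl M h i P ⟩
    suc h * (2 * (h * h) * suc i * M ^ suc i)                         ∎
    where
    open ℕ.≤-Reasoning
    open +-*-Solver
    P = M ^ i
    P+h≤ : P + h ≤ suc h * P
    P+h≤ = ℕ.+-monoʳ-≤ P (ℕ.≤-trans (ℕ.≤-reflexive (≡.sym (ℕ.*-identityʳ h))) (ℕ.*-monoʳ-≤ h (1≤M^ i)))

  length-vertices-suc : ∀ i → length (vertices (suc i)) ≡ h + M * length (vertices i)
  length-vertices-suc i = trans (List.length-++ (map hub (allFin h)))
    (cong₂ _+_ (trans (List.length-map hub (allFin h)) (length-allFin h))
      (trans (length-cartesianProductWith sub (allFin M) (vertices i)) (cong (_* length (vertices i)) (length-allFin M))))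

  -- The extra `h` on the left lets the induction absorb the `h` hubs added at each level.
  length-vertices-bound : ∀ i → length (vertices i) + h ≤ 3 * h * M ^ i
  length-vertices-bound zero = ℕ.≤-reflexive (begin
    length leaves + h       ≡⟨ cong (_+ h) (trans (length-cartesianProductWith leaf (allFin h) _) (cong (_* 2) (length-allFin h))) ⟩
    h * 2 + h               ≡⟨ solve 1 (λ h → h :* con 2 :+ h := con 3 :* h :* con 1) refl h ⟩
    3 * h * 1               ∎)
    where
    open ≡.≡-Reasoning
    open +-*-Solver
  length-vertices-bound (suc i) = begin
    length (vertices (suc i)) + h     ≡⟨ cong (_+ h) (length-vertices-suc i) ⟩
    h + M * n + h                     ≡⟨ solve 3 (λ h M n → h :+ M :* n :+ h := M :* n :+ con 2 :* h) refl h M n ⟩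
    M * n + 2 * h                     ≤⟨ ℕ.+-monoʳ-≤ (M * n) (ℕ.*-monoˡ-≤ h 2≤M) ⟩
    M * n + M * h                     ≡⟨ ℕ.*-distribˡ-+ M n h ⟨
    M * (n + h)                       ≤⟨ ℕ.*-monoʳ-≤ M (length-vertices-bound i) ⟩
    M * (3 * h * M ^ i)               ≡⟨ solve 3 (λ M h P → M :* (con 3 :* h :* P) := con 3 :* h :* (M :* P)) refl M h (M ^ i) ⟩
    3 * h * M ^ suc i                 ∎
    where
    open ℕ.≤-Reasoning
    open +-*-Solver
    n = length (vertices i)
    2≤M : 2 ≤ M
    2≤M = ℕ.≤-trans (ℕ.≤-trans (s≤s (s≤s z≤n)) (ℕ.m≤m*n 8 (suc h))) 8+8h≤M

  M≤size : M ≤ size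
  M≤size = begin
    M                                 ≡⟨ ℕ.*-identityʳ M ⟨
    M * 1                             ≤⟨ ℕ.*-monoʳ-≤ M nonempty ⟩
    M * length (vertices k)           ≤⟨ ℕ.m≤n+m _ h ⟩
    h + M * length (vertices k)       ≡⟨ length-vertices-suc k ⟨
    size                              ∎
    where
    open ℕ.≤-Reasoning
    nonempty : 1 ≤ length (vertices k)
    nonempty = ℕ.≤-trans (s≤s z≤n) (Fin.toℕ<n (Any.index (∈-vertices (hub {double j} t₀))))

  double≡2* : ∀ i → double i ≡ 2 * i
  double≡2* zero    = refl
  double≡2* (suc i) = trans (cong (2 +_) (double≡2* i)) (cong suc (≡.sym (ℕ.+-suc i (i + 0))))

  shortcut-bound : ∀ {ord n} → ord ↭ allFin size → ShortcutCount 𝒢 ord n → h * size * J ≤ 24 * n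
  shortcut-bound {ord} {n} ord↭ run = begin
    h * size * J               ≤⟨ ℕ.*-monoˡ-≤ J (ℕ.*-monoʳ-≤ h (ℕ.≤-trans (ℕ.m≤m+n size h) (length-vertices-bound K))) ⟩
    h * (3 * h * M ^ K) * J    ≡⟨ solve 3 (λ h P J → h :* (con 3 :* h :* P) :* J := con 3 :* (P :* (h :* (h :* J)))) refl h (M ^ K) J ⟩
    3 * X                      ≤⟨ ℕ.*-monoʳ-≤ 3 X≤8n ⟩
    3 * (8 * n)                ≡⟨ ℕ.*-assoc 3 8 n ⟨
    24 * n                     ∎
    where
    open ℕ.≤-Reasoning
    open +-*-Solver

    X SL : ℕ
    X  = M ^ K * (h * (h * J))
    SL = totalSlack K

    ord-unique : Unique ord
    ord-unique = SetoidPerm.Unique-resp-↭ (≡.setoid (Fin size)) (↭.↭⇒↭ₛ (↭-sym ord↭)) (Unique.allFin⁺ size)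

    slack-ord : ∑ ord (slack ∘ vert) ≡ SL
    slack-ord = ≡.trans (sum-↭ (map⁺ (slack ∘ vert) ord↭)) (cong sum
      (≡.trans (List.map-∘ (allFin size)) (cong (map slack) (≡.trans (List.map-tabulate id vert) (List.tabulate-lookup (vertices K))))))

    X≤4n+SL : X ≤ 4 * n + SL
    X≤4n+SL = begin
      X                              ≡⟨ potential-[] ⟨
      potential []                   ≤⟨ run-bound run Inv-start (All.universal (λ _ ()) ord) ord-unique
                                          (λ i → inj₂ (∈-resp-↭ (↭-sym ord↭) (∈-allFin i))) ⟩
      4 * n + ∑ ord (slack ∘ vert)   ≡⟨ cong (4 * n +_) slack-ord ⟩
      4 * n + SL                     ∎

    -- Fixes the 8 in `8 * suc h ≤ M`: a factor 4 comes from the 2 in the slack and the `2J` levels,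
    -- and another 2 leaves half of the initial potential to be paid by shortcuts.
    2SL≤X : 2 * SL ≤ X
    2SL≤X = ℕ.*-cancelˡ-≤ 4 (ℕ.*-cancelˡ-≤ (suc h) (begin
      suc h * (4 * (2 * SL))                  ≡⟨ solve 2 (λ h s → (con 1 :+ h) :* (con 4 :* (con 2 :* s)) := con 8 :* (con 1 :+ h) :* s) refl h SL ⟩
      8 * suc h * SL                          ≤⟨ ℕ.*-monoˡ-≤ SL 8+8h≤M ⟩
      M * SL                                  ≤⟨ totalSlack-bound K ⟩
      suc h * (2 * (h * h) * K * M ^ K)       ≡⟨ cong (λ z → suc h * (2 * (h * h) * z * M ^ K)) (double≡2* J) ⟩
      suc h * (2 * (h * h) * (2 * J) * M ^ K)
        ≡⟨ cong (suc h *_) (solve 3 (λ h J P → con 2 :* (h :* h) :* (con 2 :* J) :* P := con 4 :* (P :* (h :* (h :* J)))) refl h J (M ^ K)) ⟩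
      suc h * (4 * X)                         ∎))

    X≤8n : X ≤ 8 * n
    X≤8n = ℕ.+-cancelʳ-≤ X X (8 * n) (begin
      X + X                   ≡⟨ solve 1 (λ x → x :+ x := con 2 :* x) refl X ⟩
      2 * X                   ≤⟨ ℕ.*-monoʳ-≤ 2 X≤4n+SL ⟩
      2 * (4 * n + SL)        ≡⟨ solve 2 (λ n s → con 2 :* (con 4 :* n :+ s) := con 8 :* n :+ con 2 :* s) refl n SL ⟩
      8 * n + 2 * SL          ≤⟨ ℕ.+-monoʳ-≤ (8 * n) 2SL≤X ⟩
      8 * n + X               ∎)

-- Choice of the parameters

ℕ→ℚ-^ : ∀ m n → ℕ→ℚ m ^ℚ n ≡ ℕ→ℚ (m ^ n)
ℕ→ℚ-^ m zero    = refl
ℕ→ℚ-^ m (suc n) = trans (cong (ℕ→ℚ m ℚ.*_) (ℕ→ℚ-^ m n)) (≡.sym (ℕ→ℚ-* m (m ^ n)))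

^ℚ-nonNeg : ∀ {p} → 0ℚ ℚ.≤ p → ∀ n → 0ℚ ℚ.≤ p ^ℚ n
^ℚ-nonNeg 0≤p zero    = ℕ→ℚ-mono-≤ {0} {1} z≤n
^ℚ-nonNeg {p} 0≤p (suc n) = subst (ℚ._≤ p ℚ.* (p ^ℚ n)) (ℚ.*-zeroʳ p)
  (ℚ.*-monoˡ-≤-nonNeg p ⦃ ℚ.nonNegative 0≤p ⦄ (^ℚ-nonNeg 0≤p n))

^ℚ-mono : ∀ {p q} → 0ℚ ℚ.≤ p → p ℚ.≤ q → ∀ n → p ^ℚ n ℚ.≤ q ^ℚ n
^ℚ-mono 0≤p p≤q zero = ℚ.≤-refl
^ℚ-mono {p} {q} 0≤p p≤q (suc n) = ℚ.≤-trans
  (ℚ.*-monoˡ-≤-nonNeg p ⦃ ℚ.nonNegative 0≤p ⦄ (^ℚ-mono 0≤p p≤q n))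
  (ℚ.*-monoʳ-≤-nonNeg (q ^ℚ n) ⦃ ℚ.nonNegative (^ℚ-nonNeg (ℚ.≤-trans 0≤p p≤q) n) ⦄ p≤q)

≤∣numerator∣ : ∀ p → p ℚ.≤ ℕ→ℚ ℤ.∣ ℚ.↥ p ∣
≤∣numerator∣ p@(ℚ.mkℚ (ℤ.+ a) d _) rewrite ℕ→ℚ-mkℚ a = ℚ.*≤*
  (ℤ.*-monoˡ-≤-nonNeg (ℤ.+ a) {ℤ.+ 1} {ℤ.+ suc d} (ℤ.+≤+ (s≤s z≤n)))
≤∣numerator∣ p@(ℚ.mkℚ ℤ.-[1+ a ] d _) = ℚ.≤-trans {j = 0ℚ}
  (ℚ.nonPositive⁻¹ p) (ℕ→ℚ-mono-≤ {0} {suc a} z≤n)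

n≤W : ∀ n → n ≤ W (double n)
n≤W zero    = z≤n
n≤W (suc n) = begin
  suc n                   ≤⟨ s≤s (n≤W n) ⟩
  suc (W (double n))      ≤⟨ W<W (double n) ⟩
  W (suc (double n))      ≤⟨ ℕ.<⇒≤ (W<W (suc (double n))) ⟩
  W (double (suc n))      ∎
  where open ℕ.≤-Reasoning

-- Only even exponents are tried because the tree has `2J` levels; this costs a factor `64 * 64` in
-- the diameter. The search descends from the numerator of `D`, and `D` being at least 2 keeps it
-- from reaching exponent 0.
scale : ∀ D → ℕ→ℚ 2 ℚ.≤ D → ∃[ j ] (ℕ→ℚ (W (double j)) ℚ.≤ D × D ℚ.≤ ℕ→ℚ (W (double (suc j))))
scale D 2≤D = search ℤ.∣ ℚ.↥ D ∣ (ℚ.≤-trans (≤∣numerator∣ D) (ℕ→ℚ-mono-≤ (n≤W ℤ.∣ ℚ.↥ D ∣)))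
  where
  Scale : Set
  Scale = ∃[ j ] (ℕ→ℚ (W (double j)) ℚ.≤ D × D ℚ.≤ ℕ→ℚ (W (double (suc j))))

  1<D : ℕ→ℚ 1 ℚ.< D
  1<D = ℚ.<-≤-trans (ℕ→ℚ-mono-< {1} {2} (s≤s (s≤s z≤n))) 2≤D

  search : ∀ b → D ℚ.≤ ℕ→ℚ (W (double b)) → Scale
  decide : ∀ b → D ℚ.≤ ℕ→ℚ (W (double (suc b))) → Dec (D ℚ.≤ ℕ→ℚ (W (double b))) → Scale
  search zero    D≤1 = contradiction D≤1 (<⇒≱ℚ 1<D)
  search (suc b) D≤  = decide b D≤ (D ℚ.≤? ℕ→ℚ (W (double b)))
  decide b D≤ (yes le) = search b le
  decide b D≤ (no ¬le) = b , ℚ.<⇒≤ (ℚ.≰⇒> ¬le) , D≤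

module _ (h n : ℕ) (t₀ : Fin h) (1≤n : 1 ≤ n) (D : ℚ) (2≤D : ℕ→ℚ 2 ℚ.≤ D)
  (j : ℕ) (W≤D : ℕ→ℚ (W (double j)) ℚ.≤ D) (D≤W : D ℚ.≤ ℕ→ℚ (W (double (suc j)))) where

  private
    M : ℕ
    -- The factor `8 * suc h` makes the slack at most half of the potential; the factor `n` makes
    -- the graph large enough.
    M = 8 * suc h * n

    8+8h≤M : 8 * suc h ≤ M
    8+8h≤M = ℕ.m≤m*n (8 * suc h) n ⦃ ℕ.>-nonZero 1≤n ⦄

    n≤M : n ≤ M
    n≤M = ℕ.m≤n*m n (8 * suc h)

    s₀ : Fin M
    s₀ = Fin.fromℕ< (ℕ.≤-trans 1≤n n≤M)

    open Network h M t₀ s₀ (suc (double j))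
    open Bound h M t₀ s₀ j 8+8h≤M

    W-K : W (double (suc j)) ≡ W K
    W-K = refl

    D≤W-K : D ℚ.≤ ℕ→ℚ (W K)
    D≤W-K = subst (λ x → D ℚ.≤ ℕ→ℚ x) {W (double (suc j))} {W K} W-K D≤W

    16W-K : 16 * W K ≡ 16 * (64 * 64) * W (double j)
    16W-K = trans (cong (16 *_) (≡.sym (ℕ.*-assoc 64 64 (W (double j))))) (≡.sym (ℕ.*-assoc 16 (64 * 64) (W (double j))))

    small-diameter : ℕ→ℚ (16 * W K) ℚ.≤ ℕ→ℚ (16 * (64 * 64)) ℚ.* D
    small-diameter = begin
      ℕ→ℚ (16 * W K)                               ≡⟨ cong ℕ→ℚ {16 * W K} {16 * (64 * 64) * W (double j)} 16W-K ⟩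
      ℕ→ℚ (16 * (64 * 64) * W (double j))          ≡⟨ ℕ→ℚ-* (16 * (64 * 64)) (W (double j)) ⟩
      ℕ→ℚ (16 * (64 * 64)) ℚ.* ℕ→ℚ (W (double j))
        ≤⟨ ℚ.*-monoˡ-≤-nonNeg (ℕ→ℚ (16 * (64 * 64))) W≤D ⟩
      ℕ→ℚ (16 * (64 * 64)) ℚ.* D                   ∎
      where
      open ℚ.≤-Reasoning

    -- The bound on `h * size` times the logarithm of `D`, exponentiated to base 2 so that only
    -- rational powers occur.
    many-shortcuts : ∀ ord → ord ↭ allFin size → ∀ k → ShortcutCount 𝒢 ord k →
                     D ^ℚ (h * size) ℚ.≤ ℕ→ℚ 2 ^ℚ (12 * 24 * k)
    many-shortcuts ord ord↭ k run = begin
      D ^ℚ (h * size)                       ≤⟨ ^ℚ-mono 0≤D D≤W-K (h * size) ⟩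
      ℕ→ℚ (W K) ^ℚ (h * size)               ≡⟨ ℕ→ℚ-^ (W K) (h * size) ⟩
      ℕ→ℚ (W K ^ (h * size))                ≤⟨ ℕ→ℚ-mono-≤ W^≤ ⟩
      ℕ→ℚ (2 ^ (12 * 24 * k))               ≡⟨ ℕ→ℚ-^ 2 (12 * 24 * k) ⟨
      ℕ→ℚ 2 ^ℚ (12 * 24 * k)                ∎
      where
      open ℚ.≤-Reasoning
      0≤D : 0ℚ ℚ.≤ D
      0≤D = ℚ.≤-trans (ℕ→ℚ-mono-≤ {0} {2} z≤n) 2≤D
      -- The 12 arises as 6 · 2: `W K` is 64 to the power `2J`, that is, 2 to the power `12J`, and
      -- `shortcut-bound` supplies the 24.
      W^≤ : W K ^ (h * size) ≤ 2 ^ (12 * 24 * k)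
      W^≤ = ℕ.≤-trans (ℕ.≤-reflexive (trans (cong (_^ (h * size)) (ℕ.^-*-assoc 2 6 K)) (ℕ.^-*-assoc 2 (6 * K) (h * size))))
        (ℕ.^-monoʳ-≤ 2 exponent)
        where
        exponent : 6 * K * (h * size) ≤ 12 * 24 * k
        exponent = ℕ.≤-trans
          (ℕ.≤-reflexive (trans (cong (λ z → 6 * z * (h * size)) (double≡2* (suc j)))
            (solve 2 (λ J x → con 6 :* (con 2 :* J) :* x := con 12 :* (x :* J)) refl (suc j) (h * size))))
          (ℕ.≤-trans (ℕ.*-monoʳ-≤ 12 (shortcut-bound ord↭ run)) (ℕ.≤-reflexive (≡.sym (ℕ.*-assoc 12 24 k))))
          where open +-*-Solver

  witness : Σ[ G ∈ Graph ] (HighwayDim G h × DiameterBetween G (16 * (64 * 64)) D × n ≤ N G ×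
    (∀ (ord : List (Fin (N G))) → ord ↭ allFin (N G) → ∀ (k : ℕ) → ShortcutCount G ord k →
      D ^ℚ (h * N G) ℚ.≤ ℕ→ℚ 2 ^ℚ (12 * 24 * k)))
  witness = 𝒢 , highway-dimension ,
    diameter-between (16 * (64 * 64)) D (s≤s z≤n) D≤W-K small-diameter ,
    ℕ.≤-trans n≤M M≤size , many-shortcuts

theorem4 : Σ[ q ∈ ℕ ] (1 ℕ.≤ q × Σ[ C ∈ ℕ ] (1 ℕ.≤ C ×
    (∀ (h n : ℕ) → 1 ℕ.≤ h → 1 ℕ.≤ n → ∀ (D : ℚ) → ℕ→ℚ 2 ℚ.≤ D →
    Σ[ G ∈ Graph ] (HighwayDim G h ×
    DiameterBetween G C D ×
    n ℕ.≤ N G ×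
    (∀ (ord : List (Fin (N G))) → ord ↭ allFin (N G) →
    ∀ (k : ℕ) → ShortcutCount G ord k →
    D ^ℚ (h ℕ.* N G) ℚ.≤ ℕ→ℚ 2 ^ℚ (q ℕ.* k))))))
theorem4 = 12 * 24 , s≤s z≤n , 16 * (64 * 64) , s≤s z≤n ,
  λ h n 1≤h 1≤n D 2≤D → let (j , W≤D , D≤W) = scale D 2≤D in
    witness h n (Fin.fromℕ< 1≤h) 1≤n D 2≤D j W≤D D≤W
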